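{- The generating function $$F_{(132,321)}(x,p,q,u,v,s,t)=\sum_{n\ge0}\ \sum_{\pi\in S_n(132,321)} x^n p^{\operatorname{asc}(\pi)}q^{\operatorname{des}(\pi)}u^{\operatorname{lrmax}(\pi)}v^{\operatorname{rlmax}(\pi)}s^{\operatorname{lrmin}(\pi)}t^{\operatorname{rlmin}(\pi)}$$ is equal to $\dfrac{A}{(1-ptx)(1-pux)(1-ptux)}$, where $$A=1 + s t u v x + q s^2 t u v^2 x^2 - p^3 t^2 u^2 x^3 + p^2 t u x^2 (1 + t + u + s t u v x) - p x\bigl(u + s t^2 u v x (1 + q s u (-1 + v) x) + t (1 + u + s u^2 v x)\bigr).$$
   Context: For $n\ge 0$, $S_n$ denotes the set of permutations $\pi=\pi_1\cdots\pi_n$ of $[n]=\{1,\dots,n\}$ ($S_0$ consists of the empty permutation, for which all statistics are $0$). $\pi$ avoids a pattern $\tau\in S_k$ if no subsequence $\pi_{i_1}\cdots\pi_{i_k}$ ($i_1<\dots<i_k$) satisfies $\pi_{i_a}<\pi_{i_b}\iff\tau_a<\tau_b$; $S_n(\tau,\rho)$ is the set of permutations in $S_n$ avoiding both $\tau$ and $\rho$. $\operatorname{asc}(\pi)$ (resp. $\operatorname{des}(\pi)$) is the number of $i\in[n-1]$ with $\pi_i<\pi_{i+1}$ (resp. $\pi_i>\pi_{i+1}$). $\pi_i$ is a left-to-right maximum (resp. minimum) if it is larger (resp. smaller) than every $\pi_j$ with $j<i$, and a right-to-left maximum (resp. minimum) if it is larger (resp. smaller) than every $\pi_j$ with $j>i$;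 $\operatorname{lrmax},\operatorname{lrmin},\operatorname{rlmax},\operatorname{rlmin}$ count these. -}

module Defs where

open import Algebra.Bundles using (CommutativeRing)
import Algebra.Definitions.RawMonoid as RawMonoidDefinitions
import Algebra.Properties.Semiring.Exp as Exp
open import Data.Fin.Base using (Fin; zero; suc; toℕ; inject₁; _<_)
open import Data.Fin.Patterns using (0F; 1F; 2F; 3F; 4F; 5F)
import Data.Fin.Properties as Fin
open import Data.Integer.Properties using (+-*-commutativeRing)
open import Data.List.Base as List using (List; allFin; cartesianProductWith; filter; foldr; length; map)
open import Data.Nat.Base using (ℕ; zero; suc; _∸_)
open import Data.Product.Base using (∃; ∃-syntax; _×_; _,_)
open import Data.Vec.Base using (Vec; []; _∷_; lookup)
open import Data.Vec.Relation.Unary.AllPairs using (allPairs?)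
open import Data.Vec.Relation.Unary.Unique.Propositional using (Unique)
open import Function.Base using (_∘_)
open import Function.Bundles using (_⇔_; mk⇔; module Equivalence)
open import Level using (Level; 0ℓ; _⊔_)
open import Relation.Binary.Core using (Rel)
open import Relation.Nullary using (Dec; ¬_; ¬?)
open import Relation.Nullary.Decidable using (_×-dec_; _→-dec_; map′)
open import Relation.Unary using (Pred; Decidable)
import Relation.Binary.Reasoning.Setoid as SetoidReasoning

private
  variable
    a c ℓ : Level
    k l m n : ℕ

module Series (R : CommutativeRing c ℓ) where
  open CommutativeRing R
  open RawMonoidDefinitions +-rawMonoid using (sum)
  open SetoidReasoning setoid

  -- Without η, so that power series are never compared coefficient by coefficient
  -- during conversion checking; this matters once the construction is iterated.
  record PowerSeries : Set c where
    no-eta-equality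
    field coeff : ℕ → Carrier

  open PowerSeries public

  private
    Coeffs : Set c
    Coeffs = ℕ → Carrier

  infix  4 _≋_
  infixl 6 _⊕_ _⊞_
  infixl 7 _⊛_ _⊠_
  infix  8 ⊟_

  _⊕_ _⊛_ : Coeffs → Coeffs → Coeffs
  (f ⊕ g) n = f n + g n
  (f ⊛ g) n = sum {suc n} λ i → f (toℕ i) * g (n ∸ toℕ i)

  constant : Carrier → Coeffs
  constant r zero    = r
  constant r (suc n) = 0#

  _≋_ : Rel PowerSeries ℓ
  f ≋ g = ∀ n → coeff f n ≈ coeff g n

  _⊞_ _⊠_ : PowerSeries → PowerSeries → PowerSeries
  coeff (f ⊞ g) = coeff f ⊕ coeff g
  coeff (f ⊠ g) = coeff f ⊛ coeff g

  ⊟_ : PowerSeries → PowerSeries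
  coeff (⊟ f) n = - coeff f n

  C : Carrier → PowerSeries
  coeff (C r) = constant r

  X : PowerSeries
  coeff X zero          = 0#
  coeff X (suc zero)    = 1#
  coeff X (suc (suc n)) = 0#

  private
    infix 4 _≐_

    _≐_ : Rel Coeffs ℓ
    f ≐ g = ∀ n → f n ≈ g n

    shift : Coeffs → Coeffs
    shift f = f ∘ suc

    interchange : ∀ w x y z → (w + x) + (y + z) ≈ (w + y) + (x + z)
    interchange w x y z = begin
      (w + x) + (y + z)  ≈⟨ +-assoc w x (y + z) ⟩
      w + (x + (y + z))  ≈⟨ +-congˡ (+-assoc x y z) ⟨
      w + ((x + y) + z)  ≈⟨ +-congˡ (+-congʳ (+-comm x y)) ⟩
      w + ((y + x) + z)  ≈⟨ +-congˡ (+-assoc y x z) ⟩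
      w + (y + (x + z))  ≈⟨ +-assoc w y (x + z) ⟨
      (w + y) + (x + z)  ∎

    constant-0# : ∀ n → constant 0# n ≈ 0#
    constant-0# zero    = refl
    constant-0# (suc n) = refl

    ⊛-cong : ∀ {f f′ g g′} → f ≐ f′ → g ≐ g′ → f ⊛ g ≐ f′ ⊛ g′
    ⊛-cong p q zero    = +-congʳ (*-cong (p 0) (q 0))
    ⊛-cong p q (suc n) = +-cong (*-cong (p 0) (q (suc n))) (⊛-cong (p ∘ suc) q n)

    ⊛-zeroˡ : ∀ {f} g → (∀ n → f n ≈ 0#) → ∀ n → (f ⊛ g) n ≈ 0#
    ⊛-zeroˡ g p zero    = trans (+-identityʳ _) (trans (*-congʳ (p 0)) (zeroˡ _))
    ⊛-zeroˡ g p (suc n) = begin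
      _        ≈⟨ +-cong (trans (*-congʳ (p 0)) (zeroˡ _)) (⊛-zeroˡ g (p ∘ suc) n) ⟩
      0# + 0#  ≈⟨ +-identityʳ 0# ⟩
      0#       ∎

    ⊛-identityˡ : ∀ f → constant 1# ⊛ f ≐ f
    ⊛-identityˡ f zero    = trans (+-identityʳ _) (*-identityˡ _)
    ⊛-identityˡ f (suc n) = begin
      _               ≈⟨ +-cong (*-identityˡ _) (⊛-zeroˡ f (λ _ → refl) n) ⟩
      f (suc n) + 0#  ≈⟨ +-identityʳ _ ⟩
      f (suc n)       ∎

    ⊛-distribʳ : ∀ h f g → (f ⊕ g) ⊛ h ≐ (f ⊛ h) ⊕ (g ⊛ h)
    ⊛-distribʳ h f g zero    = begin
      (f 0 + g 0) * h 0 + 0#                 ≈⟨ +-cong (distribʳ _ _ _) (sym (+-identityʳ 0#)) ⟩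
      (f 0 * h 0 + g 0 * h 0) + (0# + 0#)    ≈⟨ interchange _ _ _ _ ⟩
      (f 0 * h 0 + 0#) + (g 0 * h 0 + 0#)    ∎
    ⊛-distribʳ h f g (suc n) =
      trans (+-cong (distribʳ _ _ _) (⊛-distribʳ h (shift f) (shift g) n)) (interchange _ _ _ _)

    ⊛-suc : ∀ f g n → (f ⊛ g) (suc n) ≈ f (suc n) * g 0 + (f ⊛ shift g) n
    ⊛-suc f g zero    = begin
      f 0 * g 1 + (f 1 * g 0 + 0#)  ≈⟨ +-congˡ (+-identityʳ _) ⟩
      f 0 * g 1 + f 1 * g 0         ≈⟨ +-comm _ _ ⟩
      f 1 * g 0 + f 0 * g 1         ≈⟨ +-congˡ (+-identityʳ _) ⟨
      f 1 * g 0 + (f 0 * g 1 + 0#)  ∎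
    ⊛-suc f g (suc n) = begin
      y + (shift f ⊛ g) (suc n)                 ≈⟨ +-congˡ (⊛-suc (shift f) g n) ⟩
      y + (z + w)                               ≈⟨ +-assoc _ _ _ ⟨
      (y + z) + w                               ≈⟨ +-congʳ (+-comm _ _) ⟩
      (z + y) + w                               ≈⟨ +-assoc _ _ _ ⟩
      z + (y + w)                               ∎
      where
      y = f 0 * g (suc (suc n))
      z = f (suc (suc n)) * g 0
      w = (shift f ⊛ shift g) n

    ⊛-comm : ∀ f g → f ⊛ g ≐ g ⊛ f
    ⊛-comm f g zero    = +-congʳ (*-comm _ _)
    ⊛-comm f g (suc n) = begin
      (f ⊛ g) (suc n)                      ≈⟨ ⊛-suc f g n ⟩
      f (suc n) * g 0 + (f ⊛ shift g) n    ≈⟨ +-cong (*-comm _ _) (⊛-comm f (shift g) n) ⟩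
      (g ⊛ f) (suc n)                      ∎

    ⊛-scaleˡ : ∀ r f g n → ((λ i → r * f i) ⊛ g) n ≈ r * (f ⊛ g) n
    ⊛-scaleˡ r f g zero    = begin
      (r * f 0) * g 0 + 0#  ≈⟨ +-identityʳ _ ⟩
      (r * f 0) * g 0       ≈⟨ *-assoc _ _ _ ⟩
      r * (f 0 * g 0)       ≈⟨ *-congˡ (+-identityʳ _) ⟨
      r * (f 0 * g 0 + 0#)  ∎
    ⊛-scaleˡ r f g (suc n) =
      trans (+-cong (*-assoc _ _ _) (⊛-scaleˡ r (shift f) g n)) (sym (distribˡ _ _ _))

    ⊛-assoc : ∀ f g h → (f ⊛ g) ⊛ h ≐ f ⊛ (g ⊛ h)
    ⊛-assoc f g h zero    = +-congʳ (begin
      (f 0 * g 0 + 0#) * h 0  ≈⟨ *-congʳ (+-identityʳ _) ⟩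
      (f 0 * g 0) * h 0       ≈⟨ *-assoc _ _ _ ⟩
      f 0 * (g 0 * h 0)       ≈⟨ *-congˡ (+-identityʳ _) ⟨
      f 0 * (g 0 * h 0 + 0#)  ∎)
    ⊛-assoc f g h (suc n) = begin
      (f 0 * g 0 + 0#) * h (suc n) + (((λ i → f 0 * g (suc i)) ⊕ (shift f ⊛ g)) ⊛ h) n
        ≈⟨ +-cong (trans (*-congʳ (+-identityʳ _)) (*-assoc _ _ _)) (⊛-distribʳ h (λ i → f 0 * g (suc i)) (shift f ⊛ g) n) ⟩
      f 0 * (g 0 * h (suc n)) + (((λ i → f 0 * g (suc i)) ⊛ h) n + ((shift f ⊛ g) ⊛ h) n)
        ≈⟨ +-congˡ (+-cong (⊛-scaleˡ (f 0) (shift g) h n) (⊛-assoc (shift f) g h n)) ⟩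
      f 0 * (g 0 * h (suc n)) + (f 0 * (shift g ⊛ h) n + (shift f ⊛ (g ⊛ h)) n)
        ≈⟨ +-assoc _ _ _ ⟨
      (f 0 * (g 0 * h (suc n)) + f 0 * (shift g ⊛ h) n) + (shift f ⊛ (g ⊛ h)) n
        ≈⟨ +-congʳ (distribˡ _ _ _) ⟨
      f 0 * (g ⊛ h) (suc n) + (shift f ⊛ (g ⊛ h)) n
        ∎

    ⊛-identityʳ : ∀ f → f ⊛ constant 1# ≐ f
    ⊛-identityʳ f n = trans (⊛-comm f (constant 1#) n) (⊛-identityˡ f n)

    ⊛-distribˡ : ∀ h f g → h ⊛ (f ⊕ g) ≐ (h ⊛ f) ⊕ (h ⊛ g)
    ⊛-distribˡ h f g n = begin
      (h ⊛ (f ⊕ g)) n          ≈⟨ ⊛-comm h (f ⊕ g) n ⟩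
      ((f ⊕ g) ⊛ h) n          ≈⟨ ⊛-distribʳ h f g n ⟩
      (f ⊛ h) n + (g ⊛ h) n    ≈⟨ +-cong (⊛-comm f h n) (⊛-comm g h n) ⟩
      (h ⊛ f) n + (h ⊛ g) n    ∎

  commutativeRing : CommutativeRing c ℓ
  commutativeRing = record
    { Carrier = PowerSeries
    ; _≈_     = _≋_
    ; _+_     = _⊞_
    ; _*_     = _⊠_
    ; -_      = ⊟_
    ; 0#      = C 0#
    ; 1#      = C 1#
    ; isCommutativeRing = record
      { isRing = record
        { +-isAbelianGroup = record
          { isGroup = record
            { isMonoid = record
              { isSemigroup = record
                { isMagma = record
                  { isEquivalence = record
                    { refl  = λ _ → refl
                    ; sym   = λ p n → sym (p n)
                    ; trans = λ p q n → trans (p n) (q n)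
                    }
                  ; ∙-cong = λ p q n → +-cong (p n) (q n)
                  }
                ; assoc = λ f g h n → +-assoc _ _ _
                }
              ; identity =
                  (λ f n → trans (+-congʳ (constant-0# n)) (+-identityˡ _))
                , (λ f n → trans (+-congˡ (constant-0# n)) (+-identityʳ _))
              }
            ; inverse =
                (λ f n → trans (-‿inverseˡ _) (sym (constant-0# n)))
              , (λ f n → trans (-‿inverseʳ _) (sym (constant-0# n)))
            ; ⁻¹-cong = λ p n → -‿cong (p n)
            }
          ; comm = λ f g n → +-comm _ _
          }
        ; *-cong     = ⊛-cong
        ; *-assoc    = λ f g h → ⊛-assoc (coeff f) (coeff g) (coeff h)
        ; *-identity = ⊛-identityˡ ∘ coeff , ⊛-identityʳ ∘ coeff
        ; distrib    = (λ h f g → ⊛-distribˡ (coeff h) (coeff f) (coeff g))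
                     , (λ h f g → ⊛-distribʳ (coeff h) (coeff f) (coeff g))
        }
      ; *-comm = λ f g → ⊛-comm (coeff f) (coeff g)
      }
    }

-- ℤ⟦ n ⟧ is the ring of formal power series in n variables over ℤ; the variable
-- with index zero is the outermost one, i.e. ℤ⟦ suc n ⟧ = ℤ⟦ n ⟧⟦var zero⟧.

ℤ⟦_⟧ : ℕ → CommutativeRing 0ℓ 0ℓ
ℤ⟦ zero ⟧  = +-*-commutativeRing
ℤ⟦ suc n ⟧ = Series.commutativeRing ℤ⟦ n ⟧

var : ∀ n → Fin n → CommutativeRing.Carrier ℤ⟦ n ⟧
var (suc n) zero    = Series.X ℤ⟦ n ⟧
var (suc n) (suc i) = Series.C ℤ⟦ n ⟧ (var n i)

module Fraction (R : CommutativeRing c ℓ) where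
  open CommutativeRing R

  infix 4 _≈_/_

  -- The denominator is required to be a unit.
  record _≈_/_ (f g h : Carrier) : Set (c ⊔ ℓ) where
    field
      h⁻¹      : Carrier
      h*h⁻¹≈1  : h * h⁻¹ ≈ 1#
      f≈g*h⁻¹  : f ≈ g * h⁻¹

-- One-line notation, with letters 0, …, n-1 in place of 1, …, n.

Word : ℕ → Set
Word n = Vec (Fin n) n

IsPermutation : Word n → Set
IsPermutation π = Unique π

Occurrence : Word k → Word n → Vec (Fin n) k → Set
Occurrence τ π i =
    (∀ a b → a < b → lookup i a < lookup i b)
  × (∀ a b → (lookup π (lookup i a) < lookup π (lookup i b)) ⇔ (lookup τ a < lookup τ b))

Contains Avoids : Word k → Word n → Set
Contains τ π = ∃[ i ] Occurrence τ π i
Avoids   τ π = ¬ Contains τ π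

∃Vec? : {P : Pred (Vec (Fin n) k) a} → Decidable P → Dec (∃ P)
∃Vec? {k = zero}  P? = map′ (λ p → [] , p) (λ { ([] , p) → p }) (P? [])
∃Vec? {k = suc k} P? =
  map′ (λ { (i , is , p) → i ∷ is , p }) (λ { (i ∷ is , p) → i , is , p })
       (Fin.any? λ i → ∃Vec? (P? ∘ (i ∷_)))

isPermutation? : Decidable (IsPermutation {n})
isPermutation? = allPairs? λ x y → ¬? (x Fin.≟ y)

avoids? : (τ : Word k) → Decidable (Avoids {n = n} τ)
avoids? τ π = ¬? (∃Vec? λ i →
        (Fin.all? λ a → Fin.all? λ b → (a Fin.<? b) →-dec (lookup i a Fin.<? lookup i b))
  ×-dec (Fin.all? λ a → Fin.all? λ b →
           let P? = lookup π (lookup i a) Fin.<? lookup π (lookup i b)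
               Q? = lookup τ a Fin.<? lookup τ b
           in map′ (λ { (f , g) → mk⇔ f g })
                   (λ e → Equivalence.to e , Equivalence.from e)
                   ((P? →-dec Q?) ×-dec (Q? →-dec P?))))

vectors : List (Fin m) → ∀ n → List (Vec (Fin m) n)
vectors xs zero    = List.[ [] ]
vectors xs (suc n) = cartesianProductWith _∷_ xs (vectors xs n)

𝒮 : ∀ n → Word k → Word l → List (Word n)
𝒮 n τ ρ = filter (λ π → isPermutation? π ×-dec avoids? τ π ×-dec avoids? ρ π)
                 (vectors (allFin n) n)

number : {P : Pred (Fin n) a} → Decidable P → ℕ
number P? = length (filter P? (allFin _))

asc des lrmax lrmin rlmax rlmin : Vec (Fin m) n → ℕ

asc {n = zero}  π = 0
asc {n = suc n} π = number λ i → lookup π (inject₁ i) Fin.<? lookup π (suc i)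

des {n = zero}  π = 0
des {n = suc n} π = number λ i → lookup π (suc i) Fin.<? lookup π (inject₁ i)

lrmax π = number λ i → Fin.all? λ j → (j Fin.<? i) →-dec (lookup π j Fin.<? lookup π i)
lrmin π = number λ i → Fin.all? λ j → (j Fin.<? i) →-dec (lookup π i Fin.<? lookup π j)
rlmax π = number λ i → Fin.all? λ j → (i Fin.<? j) →-dec (lookup π j Fin.<? lookup π i)
rlmin π = number λ i → Fin.all? λ j → (i Fin.<? j) →-dec (lookup π i Fin.<? lookup π j)

module GeneratingFunction (R : CommutativeRing c ℓ)
                          (p q u v s t : CommutativeRing.Carrier R) where
  open CommutativeRing R
  open Exp semiring using (_^_)

  weight : Word n → Carrier
  weight π = p ^ asc π * q ^ des π * u ^ lrmax π * v ^ rlmax π * s ^ lrmin π * t ^ rlmin π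

  genFun : Word k → Word l → Series.PowerSeries R
  Series.coeff (genFun τ ρ) n = foldr _+_ 0# (map weight (𝒮 n τ ρ))

-- The variables of ℤ⟦ 7 ⟧ are, in order of index, x, p, q, u, v, s, t.
F : Word k → Word l → CommutativeRing.Carrier ℤ⟦ 7 ⟧
F = GeneratingFunction.genFun ℤ⟦ 6 ⟧
      (var 6 0F) (var 6 1F) (var 6 2F) (var 6 3F) (var 6 4F) (var 6 5F)

⟨132⟩ ⟨321⟩ : Word 3
⟨132⟩ = 0F ∷ 2F ∷ 1F ∷ []
⟨321⟩ = 2F ∷ 1F ∷ 0F ∷ []

{-# OPTIONS --safe #-}

-- The permutations avoiding 132 and 321 are the identity and the words
--   b+1 … b+a  1 … b  a+b+1 … n      (a, b ≥ 1, a + b ≤ n),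
-- which exchange two adjacent intervals and fix the rest.  Indeed, if π = (b+1) π′ avoids both
-- patterns, then so does the standardisation of π′, and if the latter exchanges intervals of
-- positive lengths a′ and b′, then b = b′: otherwise b+1 forms a 132 or a 321 with two letters
-- of π′.  Since all statistics of these words are explicit, summing geometric series gives
--   1 + stuvx / (1 - ptux) + q s² t u v x² / ((1 - pux) (1 - ptx)) · (v - 1 + 1 / (1 - ptux)),
-- where the last factor is v + ptux / (1 - ptux) because there are two right-to-left maxima
-- if a + b = n, but only one otherwise.

module Submission where

open import Defs
open import Algebra.Bundles using (CommutativeRing)
open import Algebra.Properties.Semiring.Exp using ()
open import Data.Fin.Patterns using (0F; 1F; 2F; 3F; 4F; 5F; 6F)
import Algebra.Properties.CommutativeSemigroup
import Algebra.Properties.CommutativeSemiring.Exp as CommutativeSemiringExp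
import Algebra.Properties.Monoid.Sum as MonoidSum
import Algebra.Properties.Ring as RingProperties
import Algebra.Properties.Semiring.Mult.TCOptimised as Mult
import Algebra.Properties.Semiring.Sum as SemiringSum
import Algebra.Solver.Ring as Solver
open import Algebra.Solver.Ring.AlmostCommutativeRing
  using (fromCommutativeRing; _-Raw-AlmostCommutative⟶_)
open import Data.Bool.Base using (true; false; if_then_else_)
open import Data.Fin.Base as Fin using (Fin; zero; suc; toℕ; fromℕ<; inject₁; punchIn; punchOut)
import Data.Fin.Properties as Fin
import Data.Integer.Base as ℤ
import Data.Integer.Properties as ℤ
open import Data.List.Base using (List; []; _∷_; _++_; allFin; concat; filter; foldr; length; map; tabulate)
open import Data.List.Membership.Propositional using (_∈_)
open import Data.List.Membership.Propositional.Properties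
  using (∈-filter⁺; ∈-filter⁻; ∈-tabulate⁺; ∈-tabulate⁻; ∈-concat⁺′; ∈-concat⁻′; ∈-allFin;
         ∈-cartesianProductWith⁺)
open import Data.List.Membership.Propositional.Properties.WithK using (unique∧set⇒bag)
open import Data.List.Relation.Binary.BagAndSetEquality using (∼bag⇒↭)
open import Data.List.Relation.Binary.Permutation.Propositional as ↭ using (_↭_)
import Data.List.Relation.Unary.All as All
import Data.List.Relation.Unary.All.Properties as All
import Data.List.Relation.Unary.AllPairs.Properties as AllPairs
open import Data.List.Relation.Unary.Any using (here; there)
open import Data.List.Relation.Unary.Unique.Propositional using (Unique; []; _∷_)
import Data.List.Relation.Unary.Unique.Propositional.Properties as Unique
import Data.Maybe.Base as Maybe
open import Data.Nat.Base as ℕ using (ℕ; zero; suc; _∸_)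
import Data.Nat.Properties as ℕ
open import Data.Sum.Base using (_⊎_; inj₁; inj₂; [_,_]′)
open import Data.Vec.Base as Vec using (Vec; []; _∷_; lookup)
import Data.Vec.Properties as Vec
import Data.Vec.Relation.Unary.Unique.Propositional.Properties as VecUnique
open import Function.Base using (_∘_; id)
open import Function.Bundles using (_⇔_; mk⇔; module Equivalence)
open import Function.Definitions using (Injective)
open import Relation.Binary.Definitions using (tri<; tri≈; tri>)
open import Relation.Binary.PropositionalEquality as ≡ using (_≡_)
import Relation.Binary.Reasoning.Setoid as SetoidReasoning
open import Relation.Nullary using (Dec; yes; no; does; ¬_; contradiction)
open import Relation.Nullary.Decidable using (_×-dec_; _→-dec_; dec⇒maybe; toSum)
open import Relation.Unary using (Pred; Decidable)

-- Each of the six statistics only compares letters at two positions, so it depends on nothing but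
-- the inversion set, and for an exchange this is the rectangle of all pairs of a position in [0, a)
-- and a position in [a, a + b). The letters drop out: what remains is to count the indices in an
-- interval, in its complement, or at one or two points. The degenerate lengths are the delicate
-- point. If a or b is 0, the exchange is the identity, whatever the other length is. The induction
-- profits from this freedom, because an identity tail may be given the middle length that suits the
-- new first letter; a list without repetitions, however, needs both lengths positive and the
-- identity as an entry of its own. With c = n - a - b fixed letters at the end, the ranges of a -
-- 1, b - 1 and c are those of a threefold Cauchy product, so the sum over the words is a
-- coefficient of a product of series as it stands. All of this holds over an arbitrary commutative
-- ring of coefficients.

-- With integer coefficients, the solver recognises cancellation in an arbitrary ring.
module RingSolver {c ℓ} (R : CommutativeRing c ℓ) where
  open CommutativeRing R
  open import Data.Integer.Base using (ℤ; +_; -[1+_]; _⊖_)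
  open RingProperties ring
    using (-0#≈0#; -‿involutive; -‿+-comm; -‿distribˡ-*; -‿distribʳ-*)
  open Mult semiring using (_×_; 1+×; ×-homo-+; ×1-homo-*)
  open SetoidReasoning setoid

  fromℤ : ℤ → Carrier
  fromℤ (+ n)    = n × 1#
  fromℤ -[1+ n ] = - (suc n × 1#)

  fromℤ-homo‿- : ∀ i → fromℤ (ℤ.- i) ≈ - fromℤ i
  fromℤ-homo‿- (+ zero)  = sym -0#≈0#
  fromℤ-homo‿- (+ suc n) = refl
  fromℤ-homo‿- -[1+ n ]  = sym (-‿involutive _)

  -- Integers of opposite signs are added through `⊖`, so this is the mixed case of additivity.
  -- Cancelling a successor on both sides corresponds to inserting `1# - 1#`.
  fromℤ-homo-⊖ : ∀ m n → fromℤ (m ⊖ n) ≈ m × 1# - n × 1#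
  fromℤ-homo-⊖ m zero = begin
    m × 1#       ≈⟨ +-identityʳ _ ⟨
    m × 1# + 0#  ≈⟨ +-congˡ -0#≈0# ⟨
    m × 1# - 0#  ∎
  fromℤ-homo-⊖ zero (suc n) = sym (+-identityˡ _)
  fromℤ-homo-⊖ (suc m) (suc n) = begin
    fromℤ (suc m ⊖ suc n)    ≡⟨ ≡.cong fromℤ (ℤ.[1+m]⊖[1+n]≡m⊖n m n) ⟩
    fromℤ (m ⊖ n)            ≈⟨ fromℤ-homo-⊖ m n ⟩
    a - b                    ≈⟨ +-congʳ (+-identityʳ a) ⟨
    (a + 0#) - b             ≈⟨ +-congʳ (+-congˡ (-‿inverseʳ 1#)) ⟨
    (a + (1# - 1#)) - b      ≈⟨ +-congʳ (+-assoc a 1# (- 1#)) ⟨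
    ((a + 1#) - 1#) - b      ≈⟨ +-assoc _ _ _ ⟩
    (a + 1#) + (- 1# - b)    ≈⟨ +-cong (+-comm a 1#) (-‿+-comm 1# b) ⟩
    (1# + a) - (1# + b)      ≈⟨ +-cong (1+× m 1#) (-‿cong (1+× n 1#)) ⟨
    suc m × 1# - suc n × 1#  ∎
    where
    a = m × 1#
    b = n × 1#

  fromℤ-homo-+ : ∀ i j → fromℤ (i ℤ.+ j) ≈ fromℤ i + fromℤ j
  fromℤ-homo-+ (+ m)    (+ n)    = ×-homo-+ 1# m n
  fromℤ-homo-+ (+ m)    -[1+ n ] = fromℤ-homo-⊖ m (suc n)
  fromℤ-homo-+ -[1+ m ] (+ n)    = trans (fromℤ-homo-⊖ n (suc m)) (+-comm _ _)
  fromℤ-homo-+ -[1+ m ] -[1+ n ] = begin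
    - (suc (suc (m ℕ.+ n)) × 1#)  ≡⟨ ≡.cong (λ k → - (suc k × 1#)) (ℕ.+-suc m n) ⟨
    - ((suc m ℕ.+ suc n) × 1#)    ≈⟨ -‿cong (×-homo-+ 1# (suc m) (suc n)) ⟩
    - (suc m × 1# + suc n × 1#)   ≈⟨ -‿+-comm _ _ ⟨
    - (suc m × 1#) - suc n × 1#   ∎

  fromℤ-homo-*⁺ : ∀ m j → fromℤ (+ m ℤ.* j) ≈ m × 1# * fromℤ j
  fromℤ-homo-*⁺ m (+ n) = begin
    fromℤ (+ m ℤ.* + n)  ≡⟨ ≡.cong fromℤ (ℤ.pos-* m n) ⟨
    (m ℕ.* n) × 1#       ≈⟨ ×1-homo-* m n ⟩
    m × 1# * n × 1#      ∎
  fromℤ-homo-*⁺ m -[1+ n ] = begin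
    fromℤ (+ m ℤ.* -[1+ n ])       ≡⟨ ≡.cong fromℤ (ℤ.neg-distribʳ-* (+ m) (+ suc n)) ⟨
    fromℤ (ℤ.- (+ m ℤ.* + suc n))  ≈⟨ fromℤ-homo‿- (+ m ℤ.* + suc n) ⟩
    - fromℤ (+ m ℤ.* + suc n)      ≈⟨ -‿cong (fromℤ-homo-*⁺ m (+ suc n)) ⟩
    - (m × 1# * suc n × 1#)        ≈⟨ -‿distribʳ-* _ _ ⟩
    m × 1# * - (suc n × 1#)        ∎

  fromℤ-homo-* : ∀ i j → fromℤ (i ℤ.* j) ≈ fromℤ i * fromℤ j
  fromℤ-homo-* (+ m)    j = fromℤ-homo-*⁺ m j
  fromℤ-homo-* -[1+ m ] j = begin
    fromℤ (-[1+ m ] ℤ.* j)       ≡⟨ ≡.cong fromℤ (ℤ.neg-distribˡ-* (+ suc m) j) ⟨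
    fromℤ (ℤ.- (+ suc m ℤ.* j))  ≈⟨ fromℤ-homo‿- (+ suc m ℤ.* j) ⟩
    - fromℤ (+ suc m ℤ.* j)      ≈⟨ -‿cong (fromℤ-homo-*⁺ (suc m) j) ⟩
    - (suc m × 1# * fromℤ j)     ≈⟨ -‿distribˡ-* _ _ ⟩
    - (suc m × 1#) * fromℤ j     ∎

  morphism : ℤ.+-*-rawRing -Raw-AlmostCommutative⟶ fromCommutativeRing R
  morphism = record
    { ⟦_⟧    = fromℤ
    ; +-homo = fromℤ-homo-+
    ; *-homo = fromℤ-homo-*
    ; -‿homo = fromℤ-homo‿-
    ; 0-homo = refl
    ; 1-homo = refl
    }

  open Solver ℤ.+-*-rawRing (fromCommutativeRing R) morphism
    (λ i j → Maybe.map (λ i≡j → reflexive (≡.cong fromℤ i≡j)) (dec⇒maybe (i ℤ.≟ j))) public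

  :1 : ∀ {n} → Polynomial n
  :1 = con (+ 1)

-- Partial fractions over a commutative ring

module _ {c ℓ} (R : CommutativeRing c ℓ) where
  open CommutativeRing R
  open Algebra.Properties.Semiring.Exp semiring using (_^_)
  open RingSolver R using (solve; _:=_; _:+_; _:*_; _:-_; _:^_; :1)
  open Fraction R
  open SetoidReasoning setoid

  module _ (x p q u v s t : Carrier) where
    numerator : Carrier
    numerator = 1# + s * t * u * v * x + q * s ^ 2 * t * u * v ^ 2 * x ^ 2
              - p ^ 3 * t ^ 2 * u ^ 2 * x ^ 3
              + p ^ 2 * t * u * x ^ 2 * (1# + t + u + s * t * u * v * x)
              - p * x * (u + s * t ^ 2 * u * v * x * (1# + q * s * u * (v - 1#) * x)
                           + t * (1# + u + s * u ^ 2 * v * x))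

    -- The right-hand side is the sum of geometric series multiplied by `d₁ * d₂ * d₃`; the last
    -- factor `v - 1 + 1/d₃` turns into `(v - 1#) * d₃ + 1#`.
    numerator-partialFractions :
      let d₁ = 1# - p * t * x
          d₂ = 1# - p * u * x
          d₃ = 1# - p * t * u * x
      in numerator ≈ d₁ * d₂ * d₃ + s * t * u * v * x * (d₁ * d₂)
                     + q * s ^ 2 * t * u * v * x ^ 2 * ((v - 1#) * d₃ + 1#)
    numerator-partialFractions = solve 7 (λ x p q u v s t →
      let d₁ = :1 :- p :* t :* x
          d₂ = :1 :- p :* u :* x
          d₃ = :1 :- p :* t :* u :* x
      in :1 :+ s :* t :* u :* v :* x :+ q :* s :^ 2 :* t :* u :* v :^ 2 :* x :^ 2
           :- p :^ 3 :* t :^ 2 :* u :^ 2 :* x :^ 3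
           :+ p :^ 2 :* t :* u :* x :^ 2 :* (:1 :+ t :+ u :+ s :* t :* u :* v :* x)
           :- p :* x :* (u :+ s :* t :^ 2 :* u :* v :* x :* (:1 :+ q :* s :* u :* (v :- :1) :* x)
                          :+ t :* (:1 :+ u :+ s :* u :^ 2 :* v :* x))
         := d₁ :* d₂ :* d₃ :+ s :* t :* u :* v :* x :* (d₁ :* d₂)
            :+ q :* s :^ 2 :* t :* u :* v :* x :^ 2 :* ((v :- :1) :* d₃ :+ :1))
      refl x p q u v s t

  -- Passes from the shape in which coefficients are computed, a constant times successive shifts by
  -- `x`, to the monomials of the numerator. The constants enter only up to `≈`, since a constant
  -- series of a product merely equals the product of the constant series.
  regroup : ∀ q u v s t x k₁ k₂ g h → k₁ ≈ s * t * u * v → k₂ ≈ q * (s * s) * t * u * v →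
    1# + k₁ * (x * g) + k₂ * (x * (x * h)) ≈
    1# + s * t * u * v * x * g + q * s ^ 2 * t * u * v * x ^ 2 * h
  regroup q u v s t x k₁ k₂ g h k₁≈ k₂≈ = trans
    (+-cong (+-congˡ (*-congʳ k₁≈)) (*-congʳ k₂≈))
    (solve 8 (λ q u v s t x g h →
       :1 :+ s :* t :* u :* v :* (x :* g) :+ q :* (s :* s) :* t :* u :* v :* (x :* (x :* h))
       := :1 :+ s :* t :* u :* v :* x :* g :+ q :* s :^ 2 :* t :* u :* v :* x :^ 2 :* h)
      refl q u v s t x g h)

  partialFractions : ∀ {f n d₁ d₂ d₃ k₁ k₂ w} g₁ g₂ g₃ →
    d₁ * g₁ ≈ 1# → d₂ * g₂ ≈ 1# → d₃ * g₃ ≈ 1# →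
    n ≈ d₁ * d₂ * d₃ + k₁ * (d₁ * d₂) + k₂ * (w * d₃ + 1#) →
    f ≈ 1# + k₁ * g₃ + k₂ * (g₂ * (g₁ * (w + g₃))) →
    f ≈ n / (d₁ * d₂ * d₃)
  partialFractions {f} {n} {d₁} {d₂} {d₃} {k₁} {k₂} {w} g₁ g₂ g₃ e₁ e₂ e₃ n≈ f≈ = record
    { h⁻¹     = g₁ * g₂ * g₃
    ; h*h⁻¹≈1 = begin
        d₁ * d₂ * d₃ * (g₁ * g₂ * g₃)
          ≈⟨ solve 6 (λ d₁ d₂ d₃ g₁ g₂ g₃ → d₁ :* d₂ :* d₃ :* (g₁ :* g₂ :* g₃)
                        := d₁ :* g₁ :* (d₂ :* g₂) :* (d₃ :* g₃)) refl d₁ d₂ d₃ g₁ g₂ g₃ ⟩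
        d₁ * g₁ * (d₂ * g₂) * (d₃ * g₃)
          ≈⟨ *-cong (*-cong e₁ e₂) e₃ ⟩
        1# * 1# * 1#
          ≈⟨ trans (*-identityʳ _) (*-identityʳ _) ⟩
        1# ∎
    ; f≈g*h⁻¹ = begin
        f ≈⟨ f≈ ⟩
        1# + k₁ * g₃ + k₂ * (g₂ * (g₁ * (w + g₃)))
          -- Every `1#` inserted here marks a place where some `d * g` is substituted next, so that
          -- each summand acquires the common factor `g₁ * g₂ * g₃`.
          ≈⟨ solve 6 (λ g₁ g₂ g₃ k₁ k₂ w →
               :1 :+ k₁ :* g₃ :+ k₂ :* (g₂ :* (g₁ :* (w :+ g₃)))
                 := :1 :* :1 :* :1 :+ k₁ :* (:1 :* :1 :* g₃)
                    :+ k₂ :* (g₂ :* g₁ :* (w :* :1 :+ g₃))) refl g₁ g₂ g₃ k₁ k₂ w ⟩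
        1# * 1# * 1# + k₁ * (1# * 1# * g₃) + k₂ * (g₂ * g₁ * (w * 1# + g₃))
          ≈⟨ +-cong (+-cong (*-cong (*-cong e₁ e₂) e₃) (*-congˡ (*-congʳ (*-cong e₁ e₂))))
                    (*-congˡ (*-congˡ (+-congʳ (*-congˡ e₃)))) ⟨
        d₁ * g₁ * (d₂ * g₂) * (d₃ * g₃) + k₁ * (d₁ * g₁ * (d₂ * g₂) * g₃)
          + k₂ * (g₂ * g₁ * (w * (d₃ * g₃) + g₃))
          ≈⟨ solve 9 (λ d₁ d₂ d₃ g₁ g₂ g₃ k₁ k₂ w →
               d₁ :* g₁ :* (d₂ :* g₂) :* (d₃ :* g₃) :+ k₁ :* (d₁ :* g₁ :* (d₂ :* g₂) :* g₃)
                 :+ k₂ :* (g₂ :* g₁ :* (w :* (d₃ :* g₃) :+ g₃))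
               := (d₁ :* d₂ :* d₃ :+ k₁ :* (d₁ :* d₂) :+ k₂ :* (w :* d₃ :+ :1))
                  :* (g₁ :* g₂ :* g₃)) refl d₁ d₂ d₃ g₁ g₂ g₃ k₁ k₂ w ⟩
        (d₁ * d₂ * d₃ + k₁ * (d₁ * d₂) + k₂ * (w * d₃ + 1#)) * (g₁ * g₂ * g₃)
          ≈⟨ *-congʳ n≈ ⟨
        n * (g₁ * g₂ * g₃) ∎
    }

  [1-cx]g : ∀ c x g → (1# - c * x) * g ≈ g - c * (x * g)
  [1-cx]g = solve 3 (λ c x g → (:1 :- c :* x) :* g := g :- c :* (x :* g)) refl

-- Power series: constants, shifts and geometric series

module SeriesProperties {c ℓ} (R : CommutativeRing c ℓ) where
  open CommutativeRing R hiding (zero)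
  open CommutativeSemiringExp commutativeSemiring using (_^_)
  open MonoidSum +-monoid using (sum; sum-cong-≋; sum-replicate-zero)
  open Series R
  open RingProperties ring using (-0#≈0#)
  open SetoidReasoning setoid
  module S = CommutativeRing commutativeRing

  sum-zero : ∀ {n} (f : Fin n → Carrier) → (∀ i → f i ≈ 0#) → sum f ≈ 0#
  sum-zero {n} f f≈0 = trans (sum-cong-≋ f≈0) (sum-replicate-zero n)

  C-⊠ : ∀ r f n → coeff (C r ⊠ f) n ≈ r * coeff f n
  C-⊠ r f zero    = +-identityʳ _
  C-⊠ r f (suc n) = trans (+-congˡ (sum-zero {suc n} _ (λ i → zeroˡ (coeff f (n ∸ toℕ i))))) (+-identityʳ _)

  C-homo-* : ∀ a b → C (a * b) ≋ C a ⊠ C b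
  C-homo-* a b zero    = sym (C-⊠ a (C b) zero)
  C-homo-* a b (suc n) = sym (trans (C-⊠ a (C b) (suc n)) (zeroʳ a))

  X-⊠-zero : ∀ f → coeff (X ⊠ f) zero ≈ 0#
  X-⊠-zero f = trans (+-identityʳ _) (zeroˡ _)

  X-⊠-suc : ∀ f n → coeff (X ⊠ f) (suc n) ≈ coeff f n
  X-⊠-suc f zero = begin
    0# * coeff f 1 + (1# * coeff f 0 + 0#)  ≈⟨ +-cong (zeroˡ _) (+-identityʳ _) ⟩
    0# + 1# * coeff f 0                     ≈⟨ +-identityˡ _ ⟩
    1# * coeff f 0                          ≈⟨ *-identityˡ _ ⟩
    coeff f 0                               ∎
  X-⊠-suc f (suc n) = begin
    _ ≈⟨ +-cong (zeroˡ _) (+-cong (*-identityˡ _) (sum-zero {suc n} _ (λ i → zeroˡ (coeff f (n ∸ toℕ i))))) ⟩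
    0# + (coeff f (suc n) + 0#)  ≈⟨ +-identityˡ _ ⟩
    coeff f (suc n) + 0#         ≈⟨ +-identityʳ _ ⟩
    coeff f (suc n)              ∎

  geometric : Carrier → PowerSeries
  coeff (geometric r) n = r ^ n

  geometric-inverse : ∀ r → (S.1# S.- C r ⊠ X) ⊠ geometric r ≋ S.1#
  geometric-inverse r n = trans ([1-cx]g commutativeRing (C r) X g n) (telescope n)
    where
    g = geometric r

    telescope : g S.- C r ⊠ (X ⊠ g) ≋ S.1#
    telescope zero    = begin
      1# - coeff (C r ⊠ (X ⊠ g)) 0  ≈⟨ +-congˡ (-‿cong (trans (C-⊠ r (X ⊠ g) 0) (*-congˡ (X-⊠-zero g)))) ⟩
      1# - r * 0#                   ≈⟨ +-congˡ (trans (-‿cong (zeroʳ r)) -0#≈0#) ⟩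
      1# + 0#                       ≈⟨ +-identityʳ 1# ⟩
      1#                            ∎
    telescope (suc n) = begin
      r * r ^ n - coeff (C r ⊠ (X ⊠ g)) (suc n)
        ≈⟨ +-congˡ (-‿cong (trans (C-⊠ r (X ⊠ g) (suc n)) (*-congˡ (X-⊠-suc g n)))) ⟩
      r * r ^ n - r * r ^ n         ≈⟨ -‿inverseʳ _ ⟩
      0#                            ∎

module Combinatorics where
  open import Data.Nat.Base
  open import Data.Product.Base using (∃; _×_; _,_; proj₁; proj₂)
  open import Data.Nat.Properties
  open import Relation.Binary.PropositionalEquality hiding ([_])
  open Equivalence using (to; from)

  private variable
    a b k m n i j v w : ℕ

  -- Counting indices

  indicator : ∀ {p} {P : Set p} → Dec P → ℕ
  indicator P? = if does P? then 1 else 0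

  length-filter-∷ : ∀ {a p} {A : Set a} {P : Pred A p} (P? : Decidable P) x xs →
    length (filter P? (x ∷ xs)) ≡ indicator (P? x) + length (filter P? xs)
  length-filter-∷ P? x xs with does (P? x)
  ... | true  = refl
  ... | false = refl

  -- The tail of `allFin (suc n)` is `tabulate suc` and not `allFin n`. Absorbing the index map into
  -- the predicate is what makes `number` recursive in `n`; the induction requires an arbitrary `f`.
  length-filter-tabulate : ∀ {a p n} {A : Set a} {P : Pred A p} (P? : Decidable P) (f : Fin n → A) →
    length (filter P? (tabulate f)) ≡ number (P? ∘ f)
  length-filter-tabulate {n = zero}  P? f = refl
  length-filter-tabulate {n = suc n} P? f = begin
    length (filter P? (f zero ∷ tabulate (f ∘ suc)))
      ≡⟨ length-filter-∷ P? (f zero) _ ⟩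
    indicator (P? (f zero)) + length (filter P? (tabulate (f ∘ suc)))
      ≡⟨ cong (_ +_) (length-filter-tabulate P? (f ∘ suc)) ⟩
    indicator (P? (f zero)) + number (P? ∘ f ∘ suc)
      ≡⟨ cong (_ +_) (length-filter-tabulate (P? ∘ f) suc) ⟨
    indicator (P? (f zero)) + length (filter (P? ∘ f) (tabulate suc))
      ≡⟨ length-filter-∷ (P? ∘ f) zero _ ⟨
    number (P? ∘ f) ∎
    where open ≡-Reasoning

  number-suc : ∀ {n p} {P : Pred (Fin (suc n)) p} (P? : Decidable P) →
    number P? ≡ indicator (P? zero) + number (P? ∘ suc)
  number-suc P? = trans (length-filter-∷ P? zero _) (cong (_ +_) (length-filter-tabulate P? suc))

  indicator-yes : ∀ {p} {P : Set p} (P? : Dec P) → P → indicator P? ≡ 1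
  indicator-yes (yes _) p = refl
  indicator-yes (no ¬p) p = contradiction p ¬p

  indicator-no : ∀ {p} {P : Set p} (P? : Dec P) → ¬ P → indicator P? ≡ 0
  indicator-no (yes p) ¬p = contradiction p ¬p
  indicator-no (no _)  ¬p = refl

  indicator-⊎ : ∀ {p q r} {P : Set p} {Q : Set q} {R : Set r} (P? : Dec P) (Q? : Dec Q) (R? : Dec R) →
    P ⇔ (Q ⊎ R) → (Q → ¬ R) → indicator P? ≡ indicator Q? + indicator R?
  indicator-⊎ P? (yes q) (yes r) P⇔ Q∩R=∅ = contradiction r (Q∩R=∅ q)
  indicator-⊎ P? (yes q) (no ¬r) P⇔ Q∩R=∅ = indicator-yes P? (from P⇔ (inj₁ q))
  indicator-⊎ P? (no ¬q) (yes r) P⇔ Q∩R=∅ = indicator-yes P? (from P⇔ (inj₂ r))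
  indicator-⊎ P? (no ¬q) (no ¬r) P⇔ Q∩R=∅ = indicator-no P? ([ ¬q , ¬r ]′ ∘ to P⇔)

  number-⊎ : ∀ {n p q r} {P : Pred (Fin n) p} {Q : Pred (Fin n) q} {R : Pred (Fin n) r}
    (P? : Decidable P) (Q? : Decidable Q) (R? : Decidable R) →
    (∀ i → P i ⇔ (Q i ⊎ R i)) → (∀ i → Q i → ¬ R i) → number P? ≡ number Q? + number R?
  number-⊎ {zero}  P? Q? R? P⇔ Q∩R=∅ = refl
  number-⊎ {suc n} P? Q? R? P⇔ Q∩R=∅ = begin
    number P?
      ≡⟨ number-suc P? ⟩
    indicator (P? zero) + number (P? ∘ suc)
      ≡⟨ cong₂ _+_ (indicator-⊎ (P? zero) (Q? zero) (R? zero) (P⇔ zero) (Q∩R=∅ zero))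
                   (number-⊎ (P? ∘ suc) (Q? ∘ suc) (R? ∘ suc) (P⇔ ∘ suc) (Q∩R=∅ ∘ suc)) ⟩
    (indicator (Q? zero) + indicator (R? zero)) + (number (Q? ∘ suc) + number (R? ∘ suc))
      ≡⟨ +-interchange (indicator (Q? zero)) (indicator (R? zero)) _ _ ⟩
    (indicator (Q? zero) + number (Q? ∘ suc)) + (indicator (R? zero) + number (R? ∘ suc))
      ≡⟨ cong₂ _+_ (number-suc Q?) (number-suc R?) ⟨
    number Q? + number R? ∎
    where
    open ≡-Reasoning
    open Algebra.Properties.CommutativeSemigroup +-commutativeSemigroup
      using () renaming (interchange to +-interchange)

  -- The bounds may come in either order: truncated subtraction gives 0 for an empty interval.
  number-interval : ∀ {n p} {P : Pred (Fin n) p} (P? : Decidable P) l h → h ≤ n →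
    (∀ i → P i ⇔ (l ≤ toℕ i × toℕ i < h)) → number P? ≡ h ∸ l
  number-interval {zero}  P? l zero h≤n P⇔ = sym (0∸n≡0 l)
  number-interval {suc n} P? l zero h≤n P⇔ = begin
    number P?
      ≡⟨ number-suc P? ⟩
    indicator (P? zero) + number (P? ∘ suc)
      ≡⟨ cong₂ _+_ (indicator-no (P? zero) λ p → contradiction (proj₂ (to (P⇔ zero) p)) λ ())
           (number-interval (P? ∘ suc) l zero z≤n λ i → mk⇔
             (λ p → contradiction (proj₂ (to (P⇔ (suc i)) p)) λ ())
             (λ ())) ⟩
    0 ∸ l ∎
    where open ≡-Reasoning
  number-interval {suc n} P? zero (suc h) (s≤s h≤n) P⇔ = begin
    number P?
      ≡⟨ number-suc P? ⟩
    indicator (P? zero) + number (P? ∘ suc)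
      ≡⟨ cong₂ _+_ (indicator-yes (P? zero) (from (P⇔ zero) (z≤n , z<s)))
           (number-interval (P? ∘ suc) zero h h≤n λ i → mk⇔
             (λ p → z≤n , s<s⁻¹ (proj₂ (to (P⇔ (suc i)) p)))
             (λ (_ , i<h) → from (P⇔ (suc i)) (z≤n , s<s i<h))) ⟩
    suc h ∎
    where open ≡-Reasoning
  number-interval {suc n} P? (suc l) (suc h) (s≤s h≤n) P⇔ = begin
    number P?
      ≡⟨ number-suc P? ⟩
    indicator (P? zero) + number (P? ∘ suc)
      ≡⟨ cong₂ _+_ (indicator-no (P? zero) λ p → contradiction (proj₁ (to (P⇔ zero) p)) λ ())
           (number-interval (P? ∘ suc) l h h≤n λ i → mk⇔
             (λ p → let l≤i , i<h = to (P⇔ (suc i)) p in s≤s⁻¹ l≤i , s<s⁻¹ i<h)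
             (λ (l≤i , i<h) → from (P⇔ (suc i)) (s≤s l≤i , s<s i<h))) ⟩
    h ∸ l ∎
    where open ≡-Reasoning

  number-singleton : ∀ {n p} {P : Pred (Fin n) p} (P? : Decidable P) k → k < n →
    (∀ i → P i ⇔ toℕ i ≡ k) → number P? ≡ 1
  number-singleton P? k k<n P⇔ = trans
    (number-interval P? k (suc k) k<n λ i → mk⇔
      (λ p → let i≡k = to (P⇔ i) p in ≤-reflexive (sym i≡k) , s≤s (≤-reflexive i≡k))
      (λ (k≤i , i<1+k) → from (P⇔ i) (≤-antisym (s≤s⁻¹ i<1+k) k≤i)))
    (m+n∸n≡m 1 k)

  number-pair : ∀ {n p} {P : Pred (Fin n) p} (P? : Decidable P) k l → k < n → l < n → k ≢ l →
    (∀ i → P i ⇔ (toℕ i ≡ k ⊎ toℕ i ≡ l)) → number P? ≡ 2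
  number-pair {n} P? k l k<n l<n k≢l P⇔ = trans
    (number-⊎ P? k? l? P⇔ (λ i i≡k i≡l → k≢l (trans (sym i≡k) i≡l)))
    (cong₂ _+_ (number-singleton k? k k<n λ i → mk⇔ id id) (number-singleton l? l l<n λ i → mk⇔ id id))
    where
    k? : Decidable λ (i : Fin n) → toℕ i ≡ k
    k? i = toℕ i ≟ k
    l? : Decidable λ (i : Fin n) → toℕ i ≡ l
    l? i = toℕ i ≟ l

  number-all : ∀ {n p} {P : Pred (Fin n) p} (P? : Decidable P) → (∀ i → P i) → number P? ≡ n
  number-all P? p = number-interval P? 0 _ ≤-refl λ i → mk⇔ (λ _ → z≤n , Fin.toℕ<n i) (λ _ → p i)

  number-none : ∀ {n p} {P : Pred (Fin n) p} (P? : Decidable P) → (∀ i → ¬ P i) → number P? ≡ 0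
  number-none P? ¬p = number-interval P? 0 0 z≤n λ i → mk⇔ (λ p → contradiction p (¬p i)) (λ ())

  number-complement : ∀ {n p q} {P : Pred (Fin n) p} {Q : Pred (Fin n) q}
    (P? : Decidable P) (Q? : Decidable Q) → (∀ i → P i ⇔ (¬ Q i)) → number P? + number Q? ≡ n
  number-complement P? Q? P⇔ = trans
    -- `0 ≤ toℕ i` stands for the predicate that always holds.
    (sym (number-⊎ {P = λ i → 0 ≤ toℕ i} (λ i → 0 ≤? toℕ i) P? Q?
      (λ i → mk⇔ (λ _ → [ inj₂ , inj₁ ∘ from (P⇔ i) ]′ (toSum (Q? i))) (λ _ → z≤n))
      (λ i p → to (P⇔ i) p)))
    (number-all _ λ _ → z≤n)

  -- Exchanges of adjacent intervals and their inversions

  -- The graph of the map that exchanges the adjacent intervals [0, a) and [a, a + b).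
  data Exchange (a b i v : ℕ) : Set where
    front  : i < a → v ≡ b + i → Exchange a b i v
    middle : v < b → i ≡ a + v → Exchange a b i v
    back   : a + b ≤ i → v ≡ i → Exchange a b i v

  -- The inverse of an exchange is the exchange of the swapped lengths: `front` and `middle` trade
  -- places. A graph, unlike a function, makes this a matter of relabelling, and injectivity becomes
  -- functionality of the inverse.
  exchange-sym : Exchange a b i v → Exchange b a v i
  exchange-sym             (front i<a v≡b+i)  = middle i<a v≡b+i
  exchange-sym             (middle v<b i≡a+v) = front v<b i≡a+v
  exchange-sym {a} {b} (back a+b≤i refl)  = back (≤-trans (≤-reflexive (+-comm b a)) a+b≤i) refl

  Inverted : ℕ → ℕ → ℕ → ℕ → Set
  Inverted a b i j = i < a × a ≤ j × j < a + b

  -- The hypothesis is the weak `w ≤ v`, so that the contrapositive yields the strict `v < w` at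
  -- once; with `inverted⇒>` this decides every comparison of two letters.
  inverted : i < j → Exchange a b i v → Exchange a b j w → w ≤ v → Inverted a b i j
  inverted {b = b} i<j (front _ refl) (front _ refl) w≤v = contradiction (+-monoʳ-< b i<j) (≤⇒≯ w≤v)
  inverted {a = a} i<j (front i<a refl) (middle w<b refl) w≤v = i<a , m≤m+n a _ , +-monoʳ-< a w<b
  inverted {i} {j} {a} {b} i<j (front i<a refl) (back a+b≤j refl) w≤v = contradiction
    (≤-<-trans (≤-trans (≤-reflexive (+-comm b a)) (≤-trans a+b≤j w≤v)) (+-monoʳ-< b i<a)) (<-irrefl refl)
  inverted {a = a} i<j (middle _ refl) (front j<a _) w≤v =
    contradiction (<-trans i<j j<a) (≤⇒≯ (m≤m+n a _))
  inverted {a = a} i<j (middle _ refl) (middle _ refl) w≤v =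
    contradiction (+-cancelˡ-< a _ _ i<j) (≤⇒≯ w≤v)
  inverted {a = a} {b} i<j (middle v<b _) (back a+b≤j refl) w≤v =
    contradiction (≤-<-trans (≤-trans (m≤n+m b a) (≤-trans a+b≤j w≤v)) v<b) (<-irrefl refl)
  inverted {a = a} {b} i<j (back a+b≤i _) (front j<a _) w≤v =
    contradiction (<-trans i<j j<a) (≤⇒≯ (≤-trans (m≤m+n a b) a+b≤i))
  inverted {a = a} i<j (back a+b≤i _) (middle w<b refl) w≤v =
    contradiction (<-trans i<j (+-monoʳ-< a w<b)) (≤⇒≯ a+b≤i)
  inverted i<j (back _ refl) (back _ refl) w≤v = contradiction i<j (≤⇒≯ w≤v)

  inverted⇒> : Exchange a b i v → Exchange a b j w → Inverted a b i j → w < v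
  inverted⇒> (front _ refl) (middle w<b _) _ = <-≤-trans w<b (m≤m+n _ _)
  inverted⇒> (front _ _) (front j<a _)    (_ , a≤j , _)   = contradiction j<a (≤⇒≯ a≤j)
  inverted⇒> (front _ _) (back a+b≤j _)   (_ , _ , j<a+b) = contradiction j<a+b (≤⇒≯ a+b≤j)
  inverted⇒> {a} (middle _ refl) _         (i<a , _)       = contradiction i<a (≤⇒≯ (m≤m+n a _))
  inverted⇒> {a} {b} (back a+b≤i _) _      (i<a , _)       = contradiction i<a (≤⇒≯ (≤-trans (m≤m+n a b) a+b≤i))

  exchange-functional : Exchange a b i v → Exchange a b i w → v ≡ w
  exchange-functional (front _ refl)    (front _ refl)      = refl
  exchange-functional {a} (front i<a _) (middle _ refl)     = contradiction i<a (≤⇒≯ (m≤m+n a _))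
  exchange-functional {a} {b} (front i<a _) (back a+b≤i _)  = contradiction i<a (≤⇒≯ (≤-trans (m≤m+n a b) a+b≤i))
  exchange-functional {a} (middle _ refl) (front i<a _)     = contradiction i<a (≤⇒≯ (m≤m+n a _))
  exchange-functional {a} (middle _ i≡a+v) (middle _ i≡a+w) = +-cancelˡ-≡ a _ _ (trans (sym i≡a+v) i≡a+w)
  exchange-functional {a} (middle v<b refl) (back a+b≤i _)  = contradiction (+-monoʳ-< a v<b) (≤⇒≯ a+b≤i)
  exchange-functional {a} {b} (back a+b≤i _) (front i<a _)  = contradiction i<a (≤⇒≯ (≤-trans (m≤m+n a b) a+b≤i))
  exchange-functional {a} (back a+b≤i _) (middle w<b refl)  = contradiction (+-monoʳ-< a w<b) (≤⇒≯ a+b≤i)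
  exchange-functional (back _ refl)     (back _ refl)       = refl

  exchange-injective : Exchange a b i v → Exchange a b j v → i ≡ j
  exchange-injective e e′ = exchange-functional (exchange-sym e) (exchange-sym e′)

  exchange-bounded : a + b ≤ n → i < n → Exchange a b i v → v < n
  exchange-bounded {a} {b} a+b≤n i<n (front i<a refl) =
    <-≤-trans (+-monoʳ-< b i<a) (≤-trans (≤-reflexive (+-comm b a)) a+b≤n)
  exchange-bounded {a} {b} a+b≤n i<n (middle v<b _) = <-≤-trans v<b (≤-trans (m≤n+m b a) a+b≤n)
  exchange-bounded a+b≤n i<n (back _ refl)    = i<n

  exchange-total : ∀ a b i → ∃ (Exchange a b i)
  exchange-total a b i with i <? a | i <? a + b
  ... | yes i<a | _ = b + i , front i<a refl
  ... | no i≮a  | yes i<a+b = i ∸ a , middle (+-cancelˡ-< a _ _ (subst (_< a + b) i≡a+[i∸a] i<a+b)) i≡a+[i∸a]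
    where
    i≡a+[i∸a] : i ≡ a + (i ∸ a)
    i≡a+[i∸a] = sym (m+[n∸m]≡n (≮⇒≥ i≮a))
  ... | no _    | no i≮a+b = i , back (≮⇒≥ i≮a+b) refl

  Exchanges : ℕ → ℕ → (Fin n → ℕ) → Set
  Exchanges a b f = ∀ i → Exchange a b (toℕ i) (f i)

  -- Statistics quantify over `Fin`, whereas the decisive test positions (0, the start of the middle
  -- block, the last position) are natural numbers.
  atℕ : ∀ {p} {P : ℕ → Set p} → (∀ (i : Fin n) → P (toℕ i)) → ∀ k → k < n → P k
  atℕ {P = P} p k k<n = subst P (Fin.toℕ-fromℕ< k<n) (p (fromℕ< k<n))

  exchanges-at : {f : Fin n → ℕ} → Exchanges a b f → ∀ {i v} (i<n : i < n) →
    Exchange a b i v → f (fromℕ< i<n) ≡ v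
  exchanges-at {a = a} {b} {f} ex i<n e = exchange-functional
    (subst (λ i → Exchange a b i (f (fromℕ< i<n))) (Fin.toℕ-fromℕ< i<n) (ex (fromℕ< i<n))) e

  -- Statistics read off from the inversions

  module Statistics {m n a b} (π : Vec (Fin m) n) (ex : Exchanges a b (toℕ ∘ lookup π)) where

    ascent⇔ : ∀ {i j} → i Fin.< j → (lookup π i Fin.< lookup π j) ⇔ (¬ Inverted a b (toℕ i) (toℕ j))
    ascent⇔ {i} {j} i<j = mk⇔
      (λ lt inv → <-asym lt (inverted⇒> (ex i) (ex j) inv))
      (λ ¬inv → ≰⇒> (¬inv ∘ inverted i<j (ex i) (ex j)))

    descent⇔ : ∀ {i j} → i Fin.< j → (lookup π j Fin.< lookup π i) ⇔ Inverted a b (toℕ i) (toℕ j)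
    descent⇔ {i} {j} i<j = mk⇔ (inverted i<j (ex i) (ex j) ∘ <⇒≤) (inverted⇒> (ex i) (ex j))

    lrmax⇔ : ∀ i → (∀ j → j Fin.< i → lookup π j Fin.< lookup π i)
                 ⇔ (∀ k → k < toℕ i → ¬ Inverted a b k (toℕ i))
    lrmax⇔ i = mk⇔
      (λ max k k<i → atℕ {P = λ k → k < toℕ i → ¬ Inverted a b k (toℕ i)}
        (λ j j<i → to (ascent⇔ j<i) (max j j<i)) k (<-trans k<i (Fin.toℕ<n i)) k<i)
      (λ max j j<i → from (ascent⇔ j<i) (max (toℕ j) j<i))

    lrmin⇔ : ∀ i → (∀ j → j Fin.< i → lookup π i Fin.< lookup π j)
                 ⇔ (∀ k → k < toℕ i → Inverted a b k (toℕ i))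
    lrmin⇔ i = mk⇔
      (λ min k k<i → atℕ {P = λ k → k < toℕ i → Inverted a b k (toℕ i)}
        (λ j j<i → to (descent⇔ j<i) (min j j<i)) k (<-trans k<i (Fin.toℕ<n i)) k<i)
      (λ min j j<i → from (descent⇔ j<i) (min (toℕ j) j<i))

    rlmax⇔ : ∀ i → (∀ j → i Fin.< j → lookup π j Fin.< lookup π i)
                 ⇔ (∀ k → k < n → toℕ i < k → Inverted a b (toℕ i) k)
    rlmax⇔ i = mk⇔
      (λ max → atℕ λ j i<j → to (descent⇔ i<j) (max j i<j))
      (λ max j i<j → from (descent⇔ i<j) (max (toℕ j) (Fin.toℕ<n j) i<j))

    rlmin⇔ : ∀ i → (∀ j → i Fin.< j → lookup π i Fin.< lookup π j)
                 ⇔ (∀ k → k < n → toℕ i < k → ¬ Inverted a b (toℕ i) k)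
    rlmin⇔ i = mk⇔
      (λ min → atℕ λ j i<j → to (ascent⇔ i<j) (min j i<j))
      (λ min j i<j → from (ascent⇔ i<j) (min (toℕ j) (Fin.toℕ<n j) i<j))

  -- Statistics of exchanges

  inject₁<suc : ∀ {n} (i : Fin n) → inject₁ i Fin.< suc i
  inject₁<suc i = s≤s (≤-reflexive (Fin.toℕ-inject₁ i))

  -- The statistics are unfolded by unification, so these predicates have to be named.
  module _ {m n} (π : Vec (Fin m) n) where

    lrmax? : Decidable λ i → ∀ j → j Fin.< i → lookup π j Fin.< lookup π i
    lrmax? i = Fin.all? λ j → (j Fin.<? i) →-dec (lookup π j Fin.<? lookup π i)

    lrmin? : Decidable λ i → ∀ j → j Fin.< i → lookup π i Fin.< lookup π j
    lrmin? i = Fin.all? λ j → (j Fin.<? i) →-dec (lookup π i Fin.<? lookup π j)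

    rlmax? : Decidable λ i → ∀ j → i Fin.< j → lookup π j Fin.< lookup π i
    rlmax? i = Fin.all? λ j → (i Fin.<? j) →-dec (lookup π j Fin.<? lookup π i)

    rlmin? : Decidable λ i → ∀ j → i Fin.< j → lookup π i Fin.< lookup π j
    rlmin? i = Fin.all? λ j → (i Fin.<? j) →-dec (lookup π i Fin.<? lookup π j)

  module _ {m n} (π : Vec (Fin m) (suc n)) where

    ascent? : Decidable λ i → lookup π (inject₁ i) Fin.< lookup π (suc i)
    ascent? i = lookup π (inject₁ i) Fin.<? lookup π (suc i)

    descent? : Decidable λ i → lookup π (suc i) Fin.< lookup π (inject₁ i)
    descent? i = lookup π (suc i) Fin.<? lookup π (inject₁ i)

  module IdentityStatistics {m n} (π : Vec (Fin m) (suc n)) (ex : Exchanges 0 0 (toℕ ∘ lookup π)) where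
    open Statistics π ex

    asc-identity : asc π ≡ n
    asc-identity = number-all (ascent? π) λ i → from (ascent⇔ (inject₁<suc i)) λ ()

    des-identity : des π ≡ 0
    des-identity = number-none (descent? π) λ i p → contradiction (proj₁ (to (descent⇔ (inject₁<suc i)) p)) λ ()

    lrmax-identity : lrmax π ≡ suc n
    lrmax-identity = number-all (lrmax? π) λ i → from (lrmax⇔ i) λ _ _ ()

    rlmin-identity : rlmin π ≡ suc n
    rlmin-identity = number-all (rlmin? π) λ i → from (rlmin⇔ i) λ _ _ _ ()

    lrmin-identity : lrmin π ≡ 1
    lrmin-identity = number-singleton (lrmin? π) 0 z<s λ i → mk⇔
      (λ min → n≤0⇒n≡0 (≮⇒≥ λ 0<i → contradiction (proj₁ (to (lrmin⇔ i) min 0 0<i)) λ ()))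
      (λ i≡0 → from (lrmin⇔ i) λ k k<i → contradiction (subst (k <_) i≡0 k<i) λ ())

    rlmax-identity : rlmax π ≡ 1
    rlmax-identity = number-singleton (rlmax? π) n ≤-refl λ i → mk⇔
      (λ max → ≤-antisym (s≤s⁻¹ (Fin.toℕ<n i))
        (≮⇒≥ λ i<n → contradiction (proj₁ (to (rlmax⇔ i) max n ≤-refl i<n)) λ ()))
      (λ i≡n → from (rlmax⇔ i) λ k k<1+n i<k → contradiction (<-≤-trans i<k (s≤s⁻¹ k<1+n)) (<-irrefl i≡n))

  -- Here `c` is the number of fixed letters at the end. Keeping the length as an equation allows
  -- terms to be added and cancelled instead of subtracted. The value of `rlmax` is treated
  -- separately, because it depends on whether `c` is zero.
  module RotationStatistics {m n a b c} (n≡ : suc a + suc b + c ≡ suc n)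
    (π : Vec (Fin m) (suc n)) (ex : Exchanges (suc a) (suc b) (toℕ ∘ lookup π)) where
    open Statistics π ex

    a+b≤1+n : suc a + suc b ≤ suc n
    a+b≤1+n = ≤-trans (m≤m+n _ c) (≤-reflexive n≡)

    a<a+b : suc a < suc a + suc b
    a<a+b = m<m+n (suc a) z<s

    a<1+n : suc a < suc n
    a<1+n = <-≤-trans a<a+b a+b≤1+n

    -- Two neighbouring positions lie on different sides of the boundary between the blocks only if
    -- the left one is the last of the front block, which has index `a` when counting from 0.
    descent-position : ∀ (i : Fin n) →
      Inverted (suc a) (suc b) (toℕ (inject₁ i)) (suc (toℕ i)) ⇔ toℕ i ≡ a
    descent-position i = mk⇔
      (λ (i<a , a≤i , _) → ≤-antisym (s≤s⁻¹ (subst (_< suc a) (Fin.toℕ-inject₁ i) i<a)) (s≤s⁻¹ a≤i))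
      (λ i≡a → subst (_< suc a) (sym (trans (Fin.toℕ-inject₁ i) i≡a)) ≤-refl
             , ≤-reflexive (cong suc (sym i≡a))
             , subst (_< suc a + suc b) (cong suc (sym i≡a)) a<a+b)

    des-rotation : des π ≡ 1
    des-rotation = number-singleton (descent? π) a (s≤s⁻¹ a<1+n) λ i → mk⇔
      (to (descent-position i) ∘ to (descent⇔ (inject₁<suc i)))
      (from (descent⇔ (inject₁<suc i)) ∘ from (descent-position i))

    -- Two neighbours that do not descend ascend, and there is a single descent. Two successors are
    -- added so that the count can be compared with the length without subtraction.
    asc-rotation : asc π ≡ a + b + c
    asc-rotation = suc-injective (suc-injective (begin
      2 + asc π            ≡⟨ cong suc (+-comm 1 (asc π)) ⟩
      suc (asc π + 1)      ≡⟨ cong (λ d → suc (asc π + d)) des-rotation ⟨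
      suc (asc π + des π)  ≡⟨ cong suc (number-complement (ascent? π) (descent? π) λ i → mk⇔
                                (λ p q → <-asym p q)
                                (λ ¬q → from (ascent⇔ (inject₁<suc i))
                                  (¬q ∘ from (descent⇔ (inject₁<suc i))))) ⟩
      suc n                ≡⟨ n≡ ⟨
      suc a + suc b + c    ≡⟨ cong (_+ c) (+-suc (suc a) b) ⟩
      2 + (a + b + c)      ∎))
      where open ≡-Reasoning

    -- The left-to-right maxima fill two intervals, but the remaining positions form one, the middle
    -- block, where each position is inverted with position 0. Hence the complement is counted.
    lrmax-rotation : lrmax π ≡ suc a + c
    lrmax-rotation = +-cancelʳ-≡ (suc b) _ _ (begin
      lrmax π + suc b      ≡⟨ cong (lrmax π +_) (m+n∸m≡n (suc a) (suc b)) ⟨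
      lrmax π + (suc a + suc b ∸ suc a)
        ≡⟨ cong (lrmax π +_) (number-interval Q? (suc a) (suc a + suc b) a+b≤1+n λ i → mk⇔ id id) ⟨
      lrmax π + number Q?
        ≡⟨ number-complement (lrmax? π) Q? (λ i → mk⇔
             (λ max (a≤i , i<a+b) → to (lrmax⇔ i) max 0 (<-≤-trans z<s a≤i) (z<s , a≤i , i<a+b))
             (λ ¬q → from (lrmax⇔ i) λ k k<i (_ , q) → ¬q q)) ⟩
      suc n                ≡⟨ n≡ ⟨
      suc a + suc b + c    ≡⟨ +-assoc (suc a) (suc b) c ⟩
      suc a + (suc b + c)  ≡⟨ cong (suc a +_) (+-comm (suc b) c) ⟩
      suc a + (c + suc b)  ≡⟨ +-assoc (suc a) c (suc b) ⟨
      suc a + c + suc b    ∎)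
      where
      open ≡-Reasoning
      Q? : Decidable λ (i : Fin (suc n)) → suc a ≤ toℕ i × toℕ i < suc a + suc b
      Q? i = (suc a ≤? toℕ i) ×-dec (toℕ i <? suc a + suc b)

    -- Each position of the front block fails against position `suc a`, which carries the least
    -- letter; no later position is the left end of an inversion.
    rlmin-rotation : rlmin π ≡ suc b + c
    rlmin-rotation = begin
      rlmin π
        ≡⟨ number-interval (rlmin? π) (suc a) (suc n) ≤-refl (λ i → mk⇔
             (λ min → ≮⇒≥ (λ i<a → to (rlmin⇔ i) min (suc a) a<1+n i<a (i<a , ≤-refl , a<a+b))
                    , Fin.toℕ<n i)
             (λ (a≤i , _) → from (rlmin⇔ i) λ k _ _ (i<a , _) → contradiction i<a (≤⇒≯ a≤i))) ⟩
      suc n ∸ suc a                ≡⟨ cong (_∸ suc a) n≡ ⟨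
      suc a + suc b + c ∸ suc a    ≡⟨ cong (_∸ suc a) (+-assoc (suc a) (suc b) c) ⟩
      suc a + (suc b + c) ∸ suc a  ≡⟨ m+n∸m≡n (suc a) (suc b + c) ⟩
      suc b + c                    ∎
      where open ≡-Reasoning

    -- The two blocks start at 0 and `suc a`. A position `i > 0` must be inverted with 0, so it lies
    -- in the middle block or later, and it cannot come after `suc a`, because `suc a` is the left
    -- end of no inversion.
    lrmin-rotation : lrmin π ≡ 2
    lrmin-rotation = number-pair (lrmin? π) 0 (suc a) z<s a<1+n (λ ()) λ i → mk⇔ (to′ i) (from′ i)
      where
      to′ : ∀ i → (∀ j → j Fin.< i → lookup π i Fin.< lookup π j) → toℕ i ≡ 0 ⊎ toℕ i ≡ suc a
      to′ i min with toℕ i ≟ 0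
      ... | yes i≡0 = inj₁ i≡0
      ... | no  i≢0 = inj₂ (≤-antisym
        (≮⇒≥ λ a<i → contradiction (proj₁ (to (lrmin⇔ i) min (suc a) a<i)) (<-irrefl refl))
        (proj₁ (proj₂ (to (lrmin⇔ i) min 0 (n≢0⇒n>0 i≢0)))))
      from′ : ∀ i → toℕ i ≡ 0 ⊎ toℕ i ≡ suc a → (∀ j → j Fin.< i → lookup π i Fin.< lookup π j)
      from′ i (inj₁ i≡0) = from (lrmin⇔ i) λ k k<i → contradiction (subst (k <_) i≡0 k<i) λ ()
      from′ i (inj₂ i≡a) = from (lrmin⇔ i) λ k k<i →
        subst (k <_) i≡a k<i , ≤-reflexive (sym i≡a) , subst (_< suc a + suc b) (sym i≡a) a<a+b

  module _ {m n a b} (n≡ : suc a + suc b ≡ suc n)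
    (π : Vec (Fin m) (suc n)) (ex : Exchanges (suc a) (suc b) (toℕ ∘ lookup π)) where
    open Statistics π ex

    rlmax-rotation-full : rlmax π ≡ 2
    rlmax-rotation-full = number-pair (rlmax? π) a n (m<n⇒m<1+n a<n) ≤-refl (<⇒≢ a<n) λ i →
      mk⇔ (to′ i) (from′ i)
      where
      a<n : a < n
      a<n = s≤s⁻¹ (≤-trans (m<m+n (suc a) z<s) (≤-reflexive n≡))
      to′ : ∀ i → (∀ j → i Fin.< j → lookup π j Fin.< lookup π i) → toℕ i ≡ a ⊎ toℕ i ≡ n
      to′ i max with toℕ i <? n
      ... | no  i≮n = inj₂ (≤-antisym (s≤s⁻¹ (Fin.toℕ<n i)) (≮⇒≥ i≮n))
      -- The test against the last position puts `i` in the front block; the test against its right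
      -- neighbour puts that neighbour outside, so `i` ends the block.
      ... | yes i<n = inj₁ (≤-antisym
        (s≤s⁻¹ (proj₁ (to (rlmax⇔ i) max n ≤-refl i<n)))
        (s≤s⁻¹ (proj₁ (proj₂ (to (rlmax⇔ i) max (suc (toℕ i)) (s≤s i<n) ≤-refl)))))
      from′ : ∀ i → toℕ i ≡ a ⊎ toℕ i ≡ n → (∀ j → i Fin.< j → lookup π j Fin.< lookup π i)
      from′ i (inj₁ i≡a) = from (rlmax⇔ i) λ k k<n i<k →
        subst (_< suc a) (sym i≡a) ≤-refl , subst (_< k) i≡a i<k , subst (k <_) (sym n≡) k<n
      from′ i (inj₂ i≡n) = from (rlmax⇔ i) λ k k<1+n i<k →
        contradiction (<-≤-trans i<k (s≤s⁻¹ k<1+n)) (<-irrefl i≡n)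

  module _ {m n a b c} (n≡ : suc a + suc b + suc c ≡ suc n)
    (π : Vec (Fin m) (suc n)) (ex : Exchanges (suc a) (suc b) (toℕ ∘ lookup π)) where
    open Statistics π ex

    rlmax-rotation-partial : rlmax π ≡ 1
    rlmax-rotation-partial = number-singleton (rlmax? π) n ≤-refl λ i → mk⇔
      (λ max → ≤-antisym (s≤s⁻¹ (Fin.toℕ<n i))
        (≮⇒≥ λ i<n → contradiction (proj₂ (proj₂ (to (rlmax⇔ i) max n ≤-refl i<n))) (≤⇒≯ a+b≤n)))
      (λ i≡n → from (rlmax⇔ i) λ k k<1+n i<k → contradiction (<-≤-trans i<k (s≤s⁻¹ k<1+n)) (<-irrefl i≡n))
      where
      a+b≤n : suc a + suc b ≤ n
      a+b≤n = s≤s⁻¹ (≤-trans (m<m+n (suc a + suc b) z<s) (≤-reflexive n≡))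

  -- Classification of the words avoiding 132 and 321

  No132 No321 : (Fin n → Fin n) → Set
  No132 f = ∀ i j k → i Fin.< j → j Fin.< k → f i Fin.< f k → ¬ (f k Fin.< f j)
  No321 f = ∀ i j k → i Fin.< j → j Fin.< k → f k Fin.< f j → ¬ (f j Fin.< f i)

  increasing₃ : {x y z : Fin n} → x Fin.< y → y Fin.< z → ∀ a b → a Fin.< b →
    lookup (x ∷ y ∷ z ∷ []) a Fin.< lookup (x ∷ y ∷ z ∷ []) b
  increasing₃ x<y y<z 0F 1F _ = x<y
  increasing₃ x<y y<z 0F 2F _ = <-trans x<y y<z
  increasing₃ x<y y<z 1F 2F _ = y<z
  increasing₃ x<y y<z 0F 0F ()
  increasing₃ x<y y<z 1F 0F ()
  increasing₃ x<y y<z 1F 1F (s≤s ())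
  increasing₃ x<y y<z 2F 0F ()
  increasing₃ x<y y<z 2F 1F (s≤s ())
  increasing₃ x<y y<z 2F 2F (s≤s (s≤s ()))

  increasing-reflects-< : (h : Fin k → Fin n) → (∀ a b → a Fin.< b → h a Fin.< h b) →
    ∀ {a b} → h a Fin.< h b → a Fin.< b
  increasing-reflects-< h h-inc {a} {b} ha<hb with Fin.<-cmp a b
  ... | tri< a<b _ _    = a<b
  ... | tri≈ _ refl _   = contradiction ha<hb (<-irrefl refl)
  ... | tri> _ _ b<a    = contradiction ha<hb (<-asym (h-inc b a b<a))

  -- The letters `x`, `y`, `z` are sorted and `τ` tells how they are arranged, so both directions of
  -- the order isomorphism come from the strictly increasing map `lookup (x ∷ y ∷ z ∷ [])`.
  occurrence₃ : (τ : Word 3) (π : Word n) {i j k x y z : Fin n} →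
    i Fin.< j → j Fin.< k → x Fin.< y → y Fin.< z →
    (∀ a → lookup π (lookup (i ∷ j ∷ k ∷ []) a) ≡ lookup (x ∷ y ∷ z ∷ []) (lookup τ a)) →
    Occurrence τ π (i ∷ j ∷ k ∷ [])
  occurrence₃ τ π {x = x} {y} {z} i<j j<k x<y y<z eq = increasing₃ i<j j<k , λ a b → mk⇔
    (λ lt → increasing-reflects-< (lookup (x ∷ y ∷ z ∷ [])) (increasing₃ x<y y<z)
              (subst₂ Fin._<_ (eq a) (eq b) lt))
    (λ lt → subst₂ Fin._<_ (sym (eq a)) (sym (eq b)) (increasing₃ x<y y<z _ _ lt))

  avoids-132⇔ : (π : Word n) → Avoids ⟨132⟩ π ⇔ No132 (lookup π)
  avoids-132⇔ π = mk⇔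
    (λ avoids i j k i<j j<k fi<fk fk<fj → avoids (i ∷ j ∷ k ∷ [] , occurrence₃ ⟨132⟩ π i<j j<k fi<fk fk<fj
      λ { 0F → refl ; 1F → refl ; 2F → refl }))
    (λ { no132 (i ∷ j ∷ k ∷ [] , inc , iso) → no132 i j k (inc 0F 1F z<s) (inc 1F 2F (s<s z<s))
           (from (iso 0F 2F) z<s) (from (iso 2F 1F) (s<s z<s)) })

  avoids-321⇔ : (π : Word n) → Avoids ⟨321⟩ π ⇔ No321 (lookup π)
  avoids-321⇔ π = mk⇔
    (λ avoids i j k i<j j<k fk<fj fj<fi → avoids (i ∷ j ∷ k ∷ [] , occurrence₃ ⟨321⟩ π i<j j<k fk<fj fj<fi
      λ { 0F → refl ; 1F → refl ; 2F → refl }))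
    (λ { no321 (i ∷ j ∷ k ∷ [] , inc , iso) → no321 i j k (inc 0F 1F z<s) (inc 1F 2F (s<s z<s))
           (from (iso 2F 1F) z<s) (from (iso 1F 0F) (s<s z<s)) })

  module _ {a b} (f : Fin n → Fin n) (ex : Exchanges a b (toℕ ∘ f)) where

    exchange⇒injective : Injective _≡_ _≡_ f
    exchange⇒injective {i} {j} fi≡fj = Fin.toℕ-injective
      (exchange-injective (ex i) (subst (Exchange a b (toℕ j) ∘ toℕ) (sym fi≡fj) (ex j)))

    -- The middle letter would be the left end of one inversion and the right end of another, thus
    -- on both sides of `a`.
    exchange⇒no321 : No321 f
    exchange⇒no321 i j k i<j j<k fk<fj fj<fi =
      contradiction (proj₁ (inverted j<k (ex j) (ex k) (<⇒≤ fk<fj)))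
                    (≤⇒≯ (proj₁ (proj₂ (inverted i<j (ex i) (ex j) (<⇒≤ fj<fi)))))

    -- If `j` and `k` are inverted, then `j` lies in the front block, and so does the earlier `i`;
    -- hence `i` and `k` are inverted as well.
    exchange⇒no132 : No132 f
    exchange⇒no132 i j k i<j j<k fi<fk fk<fj =
      let j<a , a≤k , k<a+b = inverted j<k (ex j) (ex k) (<⇒≤ fk<fj)
      in <-asym fi<fk (inverted⇒> (ex i) (ex k) (<-trans i<j j<a , a≤k , k<a+b))

  -- Induction on the first letter

  toℕ-punchIn-< : (b : Fin (suc n)) (i : Fin n) → toℕ i < toℕ b → toℕ (punchIn b i) ≡ toℕ i
  toℕ-punchIn-< (suc b) zero    i<b       = refl
  toℕ-punchIn-< (suc b) (suc i) (s<s i<b) = cong suc (toℕ-punchIn-< b i i<b)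

  toℕ-punchIn-≥ : (b : Fin (suc n)) (i : Fin n) → toℕ b ≤ toℕ i → toℕ (punchIn b i) ≡ suc (toℕ i)
  toℕ-punchIn-≥ zero    i       b≤i       = refl
  toℕ-punchIn-≥ (suc b) (suc i) (s≤s b≤i) = cong suc (toℕ-punchIn-≥ b i b≤i)

  -- Putting the letter `b` in front raises the letters from `b` on. When `b` is also the length of
  -- the middle block, its letters stay, those of the front block move up by one, and the new letter
  -- extends the front block to the left.
  exchange-punchIn : ∀ {a i} (b : Fin (suc n)) (v : Fin n) →
    Exchange a (toℕ b) i (toℕ v) → Exchange (suc a) (toℕ b) (suc i) (toℕ (punchIn b v))
  exchange-punchIn {i = i} b v (front i<a v≡b+i) = front (s<s i<a)
    (trans (toℕ-punchIn-≥ b v (≤-trans (m≤m+n _ i) (≤-reflexive (sym v≡b+i))))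
           (trans (cong suc v≡b+i) (sym (+-suc (toℕ b) i))))
  exchange-punchIn {a = a} {i} b v (middle v<b i≡a+v) =
    subst (Exchange (suc a) (toℕ b) (suc i)) (sym (toℕ-punchIn-< b v v<b)) (middle v<b (cong suc i≡a+v))
  exchange-punchIn {a = a} {i} b v (back a+b≤i v≡i) =
    back (s≤s a+b≤i) (trans (toℕ-punchIn-≥ b v (≤-trans (m≤n+m _ a) (≤-trans a+b≤i (≤-reflexive (sym v≡i)))))
                            (cong suc v≡i))

  exchange-trivialˡ : ∀ {b i v} → Exchange 0 b i v → v ≡ i
  exchange-trivialˡ (middle _ refl) = refl
  exchange-trivialˡ (back _ refl)   = refl

  exchange-trivialʳ : ∀ {a i v} → Exchange a 0 i v → v ≡ i
  exchange-trivialʳ (front _ refl) = refl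
  exchange-trivialʳ (back _ refl)  = refl

  classify : (f : Fin n → Fin n) → Injective _≡_ _≡_ f → No132 f → No321 f →
    ∃ λ a → ∃ λ b → a + b ≤ n × Exchanges a b (toℕ ∘ f)
  classify {zero}  f f-inj no132 no321 = 0 , 0 , z≤n , λ ()
  classify {suc n} f f-inj no132 no321 = extend (classify g g-inj
    (λ i j k i<j j<k gi<gk gk<gj →
      no132 (suc i) (suc j) (suc k) (s<s i<j) (s<s j<k) (g<⇒f< gi<gk) (g<⇒f< gk<gj))
    (λ i j k i<j j<k gk<gj gj<gi →
      no321 (suc i) (suc j) (suc k) (s<s i<j) (s<s j<k) (g<⇒f< gk<gj) (g<⇒f< gj<gi)))
    where
    f₀ = f zero

    f₀≢ : ∀ i → f₀ ≢ f (suc i)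
    f₀≢ i f₀≡ with () ← f-inj f₀≡

    g : Fin n → Fin n
    g i = punchOut (f₀≢ i)

    f≡ : ∀ i → punchIn f₀ (g i) ≡ f (suc i)
    f≡ i = Fin.punchIn-punchOut (f₀≢ i)

    g-inj : Injective _≡_ _≡_ g
    g-inj {i} {j} gi≡gj = Fin.suc-injective (f-inj (Fin.punchOut-injective (f₀≢ i) (f₀≢ j) gi≡gj))

    g<⇒f< : ∀ {i j} → g i Fin.< g j → f (suc i) Fin.< f (suc j)
    g<⇒f< {i} {j} gi<gj = ≰⇒> λ fj≤fi → contradiction gi<gj
      (≤⇒≯ (Fin.punchOut-mono-≤ (f₀≢ j) (f₀≢ i) fj≤fi))

    below : ∀ {i} → toℕ (g i) < toℕ f₀ → f (suc i) Fin.< f₀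
    below {i} gi<f₀ = subst (_< toℕ f₀)
      (trans (sym (toℕ-punchIn-< f₀ (g i) gi<f₀)) (cong toℕ (f≡ i))) gi<f₀

    above : ∀ {i} → toℕ f₀ ≤ toℕ (g i) → f₀ Fin.< f (suc i)
    above {i} f₀≤gi = subst (toℕ f₀ <_)
      (trans (sym (toℕ-punchIn-≥ f₀ (g i) f₀≤gi)) (cong toℕ (f≡ i))) (s≤s f₀≤gi)

    prepend : ∀ a → a + toℕ f₀ ≤ n → Exchanges a (toℕ f₀) (toℕ ∘ g) →
      ∃ λ a → ∃ λ b → a + b ≤ suc n × Exchanges a b (toℕ ∘ f)
    prepend a a+f₀≤n ex = suc a , toℕ f₀ , s≤s a+f₀≤n , λ
      { zero    → front z<s (sym (+-identityʳ _))
      ; (suc i) → subst (Exchange (suc a) (toℕ f₀) (suc (toℕ i)) ∘ toℕ) (f≡ i)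
                        (exchange-punchIn f₀ (g i) (ex i))
      }

    -- The identity is an exchange with empty front block and a middle block of any length; the
    -- length `f₀` is the one to which `prepend` applies.
    prepend-identity : (∀ i → toℕ (g i) ≡ toℕ i) → ∃ λ a → ∃ λ b → a + b ≤ suc n × Exchanges a b (toℕ ∘ f)
    prepend-identity g≡id = prepend 0 (s≤s⁻¹ (Fin.toℕ<n f₀)) λ i → exchange-id (g≡id i)
      where
      exchange-id : ∀ {b i v} → v ≡ i → Exchange 0 b i v
      exchange-id {b} {i} refl with i <? b
      ... | yes i<b = middle i<b refl
      ... | no  i≮b = back (≮⇒≥ i≮b) refl

    value-< : ∀ {a b i j v w} → Exchanges a b (toℕ ∘ g) →
      (i<n : i < n) → Exchange a b i v → (j<n : j < n) → Exchange a b j w →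
      v < w → f (suc (fromℕ< i<n)) Fin.< f (suc (fromℕ< j<n))
    value-< ex i<n e j<n e′ v<w =
      g<⇒f< (subst₂ _<_ (sym (exchanges-at ex i<n e)) (sym (exchanges-at ex j<n e′)) v<w)

    index-< : ∀ {i j} (i<n : i < n) (j<n : j < n) → i < j → fromℕ< i<n Fin.< fromℕ< j<n
    index-< i<n j<n i<j = subst₂ _<_ (sym (Fin.toℕ-fromℕ< i<n)) (sym (Fin.toℕ-fromℕ< j<n)) i<j

    extend : (∃ λ a → ∃ λ b → a + b ≤ n × Exchanges a b (toℕ ∘ g)) →
             ∃ λ a → ∃ λ b → a + b ≤ suc n × Exchanges a b (toℕ ∘ f)
    extend (zero  , b     , _     , ex) = prepend-identity (exchange-trivialˡ ∘ ex)
    extend (suc a , zero  , _     , ex) = prepend-identity (exchange-trivialʳ ∘ ex)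
    extend (suc a , suc b , a+b≤n , ex) with <-cmp (toℕ f₀) (suc b)
    ... | tri≈ _ f₀≡b _ = prepend (suc a) (subst (λ b → suc a + b ≤ n) (sym f₀≡b) a+b≤n)
                                  (subst (λ b → Exchanges (suc a) b (toℕ ∘ g)) (sym f₀≡b) ex)
    -- A 132: `f₀`, then the first letter of the front block (`suc b` in `g`), then the last letter
    -- of the middle block (`b` in `g`, hence raised above `f₀` in `f`).
    ... | tri< f₀<b _ _ = contradiction
      (value-< ex k<n (middle ≤-refl refl) 0<n (front z<s refl) (m≤m+n (suc b) 0))
      (no132 zero (suc (fromℕ< 0<n)) (suc (fromℕ< k<n)) z<s (s<s (index-< 0<n k<n z<s))
        (above (≤-trans (s≤s⁻¹ f₀<b) (≤-reflexive (sym (exchanges-at ex k<n (middle ≤-refl refl)))))))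
      where
      k<n : suc a + b < n
      k<n = subst (_≤ n) (+-suc (suc a) b) a+b≤n
      0<n : 0 < n
      0<n = ≤-<-trans z≤n k<n
    -- A 321: `f₀`, then the first letter of the front block (`suc b` in `g`), then the first letter
    -- of the middle block (0 in `g`).
    ... | tri> _ _ b<f₀ = contradiction
      (below (subst (_< toℕ f₀) (sym (exchanges-at ex 0<n (front z<s (sym (+-identityʳ _))))) b<f₀))
      (no321 zero (suc (fromℕ< 0<n)) (suc (fromℕ< k<n)) z<s (s<s (index-< 0<n k<n z<s))
        (value-< ex k<n (middle z<s (sym (+-identityʳ _))) 0<n (front z<s refl) z<s))
      where
      k<n : suc a < n
      k<n = <-≤-trans (m<m+n (suc a) z<s) a+b≤n
      0<n : 0 < n
      0<n = ≤-<-trans z≤n k<n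

  -- Explicit list of the avoiding words

  -- Opaque, since conversion checking would otherwise unfold whole lists of these words.
  opaque
    rotation : ∀ a b → .(a + b ≤ n) → Word n
    rotation a b a+b≤n = Vec.tabulate λ i →
      fromℕ< (exchange-bounded a+b≤n (Fin.toℕ<n i) (proj₂ (exchange-total a b (toℕ i))))

    exchanges-rotation : ∀ a b .(a+b≤n : a + b ≤ n) → Exchanges a b (toℕ ∘ lookup (rotation a b a+b≤n))
    exchanges-rotation a b a+b≤n i = subst (Exchange a b (toℕ i))
      (sym (trans (cong toℕ (Vec.lookup∘tabulate _ i)) (Fin.toℕ-fromℕ< _)))
      (proj₂ (exchange-total a b (toℕ i)))

  exchanges⇒≡ : (π ρ : Vec (Fin m) n) → Exchanges a b (toℕ ∘ lookup π) → Exchanges a b (toℕ ∘ lookup ρ) → π ≡ ρ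
  exchanges⇒≡ π ρ exπ exρ = begin
    π                        ≡⟨ Vec.tabulate∘lookup π ⟨
    Vec.tabulate (lookup π)  ≡⟨ Vec.tabulate-cong (λ i → Fin.toℕ-injective (exchange-functional (exπ i) (exρ i))) ⟩
    Vec.tabulate (lookup ρ)  ≡⟨ Vec.tabulate∘lookup ρ ⟩
    ρ                        ∎
    where open ≡-Reasoning

  -- For positive lengths, the front length is the position of the letter 0 and the middle length is
  -- the letter at position 0.
  exchanges-unique : ∀ {a b a′ b′} {f : Fin n → ℕ} → suc a + suc b ≤ n →
    Exchanges (suc a) (suc b) f → Exchanges (suc a′) (suc b′) f → a ≡ a′ × b ≡ b′
  exchanges-unique {n} {a} {b} {a′} {b′} {f} a+b≤n ex ex′
    = suc-injective (exchange-injective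
        (subst (Exchange (suc a′) (suc b′) (suc a)) (exchanges-at ex a<n zero-at)
          (subst (λ i → Exchange (suc a′) (suc b′) i (f (fromℕ< a<n))) (Fin.toℕ-fromℕ< a<n) (ex′ (fromℕ< a<n))))
        zero-at)
    -- At position 0, `front` gives the letter in the form `suc b + 0`.
    , +-cancelʳ-≡ 0 b b′ (suc-injective (trans (sym (exchanges-at ex 0<n (front z<s refl)))
                                               (exchanges-at ex′ 0<n (front z<s refl))))
    where
    a<n : suc a < n
    a<n = <-≤-trans (m<m+n (suc a) z<s) a+b≤n
    0<n : 0 < n
    0<n = ≤-<-trans z≤n a<n
    zero-at : ∀ {a b} → Exchange a (suc b) a 0
    zero-at = middle z<s (sym (+-identityʳ _))

  rotation≢identity : ∀ {a b} {f : Fin n → ℕ} → 0 < n → Exchanges (suc a) (suc b) f → ¬ Exchanges 0 0 f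
  rotation≢identity 0<n ex ex₀ =
    contradiction (trans (sym (exchanges-at ex 0<n (front z<s refl))) (exchanges-at ex₀ 0<n (back z≤n refl))) λ ()

  rotation-fits : (i : Fin (suc m)) (j : Fin (suc (m ∸ toℕ i))) → suc (toℕ i) + suc (toℕ j) ≤ 2 + m
  rotation-fits {m} i j = begin
    suc (toℕ i) + suc (toℕ j)      ≡⟨ +-suc (suc (toℕ i)) (toℕ j) ⟩
    2 + (toℕ i + toℕ j)            ≤⟨ +-monoʳ-≤ 2 (+-monoʳ-≤ (toℕ i) (s≤s⁻¹ (Fin.toℕ<n j))) ⟩
    2 + (toℕ i + (m ∸ toℕ i))      ≡⟨ cong (2 +_) (m+[n∸m]≡n (s≤s⁻¹ (Fin.toℕ<n i))) ⟩
    2 + m                          ∎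
    where open ≤-Reasoning

  rotationAt : (i : Fin (suc m)) (j : Fin (suc (m ∸ toℕ i))) → Word (2 + m)
  rotationAt i j = rotation (suc (toℕ i)) (suc (toℕ j)) (rotation-fits i j)

  -- The nested ranges `suc m` and `suc (m ∸ toℕ i)` copy those of an iterated Cauchy product, and
  -- `m ∸ toℕ i ∸ toℕ j` letters remain fixed.
  rotations : ∀ m → List (List (Word (2 + m)))
  rotations m = tabulate {n = suc m} λ i → tabulate {n = suc (m ∸ toℕ i)} (rotationAt i)

  identity : ∀ n → Word n
  identity n = rotation 0 0 z≤n

  avoiders : ∀ n → List (Word n)
  avoiders zero          = identity 0 ∷ []
  avoiders (suc zero)    = identity 1 ∷ []
  avoiders (suc (suc m)) = identity (2 + m) ∷ concat (rotations m)

  exchanges-rotationAt : (i : Fin (suc m)) (j : Fin (suc (m ∸ toℕ i))) →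
    Exchanges (suc (toℕ i)) (suc (toℕ j)) (toℕ ∘ lookup (rotationAt i j))
  exchanges-rotationAt i j = exchanges-rotation _ _ (rotation-fits i j)

  exchanges-identity : Exchanges 0 0 (toℕ ∘ lookup (identity n))
  exchanges-identity = exchanges-rotation 0 0 z≤n

  ∈-rotations⁻ : {π : Word (2 + m)} → π ∈ concat (rotations m) → ∃ λ i → ∃ λ j → π ≡ rotationAt i j
  ∈-rotations⁻ {m} {π} π∈ =
    let _ , π∈row , row∈ = ∈-concat⁻′ (rotations m) π∈
        i , row≡         = ∈-tabulate⁻ {f = λ i → tabulate (rotationAt i)} row∈
        j , π≡           = ∈-tabulate⁻ {f = rotationAt i} (subst (π ∈_) row≡ π∈row)
    in i , j , π≡

  ∈-rotations⁺ : (i : Fin (suc m)) (j : Fin (suc (m ∸ toℕ i))) → rotationAt i j ∈ concat (rotations m)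
  ∈-rotations⁺ i j =
    ∈-concat⁺′ (∈-tabulate⁺ {f = rotationAt i} j) (∈-tabulate⁺ {f = λ i → tabulate (rotationAt i)} i)

  -- The types of `j` and `j′` depend on `i` and `i′`, so only their numerical values can be
  -- compared.
  rotationAt-injective : ∀ (i : Fin (suc m)) j i′ j′ → rotationAt i j ≡ rotationAt i′ j′ →
    i ≡ i′ × toℕ j ≡ toℕ j′
  rotationAt-injective i j i′ j′ eq =
    let i≡i′ , j≡j′ = exchanges-unique (rotation-fits i j) (exchanges-rotationAt i j)
                        (subst (λ π → Exchanges (suc (toℕ i′)) (suc (toℕ j′)) (toℕ ∘ lookup π)) (sym eq)
                               (exchanges-rotationAt i′ j′))
    in Fin.toℕ-injective i≡i′ , j≡j′

  exchanges-∈-rotations : {π : Word (2 + m)} → π ∈ concat (rotations m) →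
    ∃ λ (i : Fin (suc m)) → ∃ λ (j : Fin (suc (m ∸ toℕ i))) →
      Exchanges (suc (toℕ i)) (suc (toℕ j)) (toℕ ∘ lookup π)
  exchanges-∈-rotations π∈ =
    let i , j , π≡ = ∈-rotations⁻ π∈
    in i , j , subst (λ π → Exchanges (suc (toℕ i)) (suc (toℕ j)) (toℕ ∘ lookup π)) (sym π≡) (exchanges-rotationAt i j)

  avoiders-unique : ∀ n → Unique (avoiders n)
  avoiders-unique zero          = All.[] ∷ []
  avoiders-unique (suc zero)    = All.[] ∷ []
  avoiders-unique (suc (suc m)) = All.tabulate identity≢ ∷ Unique.concat⁺
    (All.tabulate⁺ λ i → Unique.tabulate⁺ λ {j} {j′} eq → Fin.toℕ-injective (proj₂ (rotationAt-injective i j i j′ eq)))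
    (AllPairs.tabulate⁺ λ {i} {i′} i≢i′ (π∈ , π∈′) →
      let j , eq = ∈-tabulate⁻ {f = rotationAt i} π∈ ; j′ , eq′ = ∈-tabulate⁻ {f = rotationAt i′} π∈′
      in i≢i′ (proj₁ (rotationAt-injective i j i′ j′ (trans (sym eq) eq′))))
    where
    identity≢ : ∀ {π} → π ∈ concat (rotations m) → identity (2 + m) ≢ π
    identity≢ {π} π∈ identity≡ =
      let i , j , ex = exchanges-∈-rotations π∈
      in rotation≢identity z<s ex (subst (λ π → Exchanges 0 0 (toℕ ∘ lookup π)) identity≡ exchanges-identity)

  avoiders-exchange : ∀ n {π} → π ∈ avoiders n → ∃ λ a → ∃ λ b → Exchanges a b (toℕ ∘ lookup π)
  avoiders-exchange zero          (here refl) = 0 , 0 , exchanges-identity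
  avoiders-exchange (suc zero)    (here refl) = 0 , 0 , exchanges-identity
  avoiders-exchange (suc (suc m)) (here refl) = 0 , 0 , exchanges-identity
  avoiders-exchange (suc (suc m)) (there π∈)  =
    let i , j , ex = exchanges-∈-rotations π∈ in suc (toℕ i) , suc (toℕ j) , ex

  identity∈avoiders : ∀ n → identity n ∈ avoiders n
  identity∈avoiders zero          = here refl
  identity∈avoiders (suc zero)    = here refl
  identity∈avoiders (suc (suc m)) = here refl

  exchange∈avoiders : ∀ n a b (π : Word n) → a + b ≤ n → Exchanges a b (toℕ ∘ lookup π) → π ∈ avoiders n
  exchange∈avoiders n zero b π _ ex =
    subst (_∈ avoiders n) (exchanges⇒≡ _ π exchanges-identity
      (back z≤n ∘ exchange-trivialˡ ∘ ex)) (identity∈avoiders n)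
  exchange∈avoiders n (suc a) zero π _ ex =
    subst (_∈ avoiders n) (exchanges⇒≡ _ π exchanges-identity
      (back z≤n ∘ exchange-trivialʳ ∘ ex)) (identity∈avoiders n)
  exchange∈avoiders zero (suc a) (suc b) π () ex
  exchange∈avoiders (suc zero) (suc a) (suc b) π (s≤s a+b≤0) ex =
    contradiction (≤-trans (≤-reflexive (sym (+-suc a b))) a+b≤0) λ ()
  exchange∈avoiders (suc (suc m)) (suc a) (suc b) π (s≤s a+1+b≤1+m) ex =
    there (subst (_∈ concat (rotations m)) (exchanges⇒≡ _ π ex′ ex)
      (∈-rotations⁺ row column))
    where
    a+b≤m : a + b ≤ m
    a+b≤m = s≤s⁻¹ (≤-trans (≤-reflexive (sym (+-suc a b))) a+1+b≤1+m)
    row : Fin (suc m)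
    row = fromℕ< (s≤s (≤-trans (m≤m+n a b) a+b≤m))
    row≡a : toℕ row ≡ a
    row≡a = Fin.toℕ-fromℕ< _
    b≤m∸row : b ≤ m ∸ toℕ row
    b≤m∸row = subst (λ a → b ≤ m ∸ a) (sym row≡a) (m+n≤o⇒m≤o∸n b (≤-trans (≤-reflexive (+-comm b a)) a+b≤m))
    column : Fin (suc (m ∸ toℕ row))
    column = fromℕ< (s≤s b≤m∸row)
    ex′ : Exchanges (suc a) (suc b) (toℕ ∘ lookup (rotationAt row column))
    ex′ = subst₂ (λ a b → Exchanges (suc a) (suc b) (toℕ ∘ lookup (rotationAt row column)))
            row≡a (Fin.toℕ-fromℕ< (s≤s b≤m∸row)) (exchanges-rotationAt row column)

  -- Comparison with the filtered list of all words

  vectors-unique : ∀ {xs : List (Fin m)} → Unique xs → ∀ n → Unique (vectors xs n)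
  vectors-unique xs! zero    = All.[] ∷ []
  vectors-unique xs! (suc n) = Unique.cartesianProductWith⁺ _∷_ Vec.∷-injective xs! (vectors-unique xs! n)

  ∈-vectors : ∀ {xs : List (Fin m)} → (∀ x → x ∈ xs) → (v : Vec (Fin m) n) → v ∈ vectors xs n
  ∈-vectors all∈ []      = here refl
  ∈-vectors all∈ (x ∷ v) = ∈-cartesianProductWith⁺ _∷_ (all∈ x) (∈-vectors all∈ v)

  -- Two lists without repetitions that have the same members agree up to order, and the order does
  -- not affect a sum of weights.
  𝒮↭avoiders : ∀ n → 𝒮 n ⟨132⟩ ⟨321⟩ ↭ avoiders n
  𝒮↭avoiders n = ∼bag⇒↭ (unique∧set⇒bag
    (Unique.filter⁺ _ (vectors-unique (Unique.allFin⁺ n) n))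
    (avoiders-unique n)
    (λ {π} → mk⇔ (sound π) (complete π)))
    where
    allowed? = λ (π : Word n) → isPermutation? π ×-dec avoids? ⟨132⟩ π ×-dec avoids? ⟨321⟩ π

    sound : ∀ π → π ∈ 𝒮 n ⟨132⟩ ⟨321⟩ → π ∈ avoiders n
    sound π π∈ =
      let _ , π! , no132 , no321 = ∈-filter⁻ allowed? {xs = vectors (allFin n) n} π∈
          a , b , a+b≤n , ex = classify (lookup π) (λ {i} {j} → VecUnique.lookup-injective π! i j)
                                 (to (avoids-132⇔ π) no132) (to (avoids-321⇔ π) no321)
      in exchange∈avoiders n a b π a+b≤n ex

    complete : ∀ π → π ∈ avoiders n → π ∈ 𝒮 n ⟨132⟩ ⟨321⟩
    complete π π∈ =
      let a , b , ex = avoiders-exchange n π∈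
      in ∈-filter⁺ allowed? (∈-vectors ∈-allFin π)
           ( subst IsPermutation (Vec.tabulate∘lookup π) (VecUnique.tabulate⁺ (exchange⇒injective (lookup π) ex))
           , from (avoids-132⇔ π) (exchange⇒no132 (lookup π) ex)
           , from (avoids-321⇔ π) (exchange⇒no321 (lookup π) ex))

-- Sums over lists

module Total {c ℓ} (R : CommutativeRing c ℓ) where
  open CommutativeRing R hiding (zero)
  open MonoidSum +-monoid using (sum; sum-cong-≋)
  open SetoidReasoning setoid

  module _ {a} {A : Set a} (f : A → Carrier) where

    total : List A → Carrier
    total xs = foldr _+_ 0# (map f xs)

    total-↭ : ∀ {xs ys} → xs ↭ ys → total xs ≈ total ys
    total-↭ ↭.refl                  = refl
    total-↭ (↭.prep x p)            = +-congˡ (total-↭ p)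
    total-↭ (↭.swap {xs} {ys} x y p) = begin
      f x + (f y + total xs)  ≈⟨ +-assoc _ _ _ ⟨
      (f x + f y) + total xs  ≈⟨ +-cong (+-comm _ _) (total-↭ p) ⟩
      (f y + f x) + total ys  ≈⟨ +-assoc _ _ _ ⟩
      f y + (f x + total ys)  ∎
    total-↭ (↭.trans p q)           = trans (total-↭ p) (total-↭ q)

    total-++ : ∀ xs ys → total (xs ++ ys) ≈ total xs + total ys
    total-++ []       ys = sym (+-identityˡ _)
    total-++ (x ∷ xs) ys = trans (+-congˡ (total-++ xs ys)) (sym (+-assoc _ _ _))

    total-tabulate : ∀ {n} (g : Fin n → A) → total (tabulate g) ≡ sum (f ∘ g)
    total-tabulate {zero}  g = ≡.refl
    total-tabulate {suc n} g = ≡.cong (λ z → f (g zero) + z) (total-tabulate (g ∘ suc))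

    total-concat-tabulate : ∀ {n} (g : Fin n → List A) → total (concat (tabulate g)) ≈ sum (total ∘ g)
    total-concat-tabulate {zero}  g = refl
    total-concat-tabulate {suc n} g = trans
      (total-++ (g zero) (concat (tabulate (g ∘ suc)))) (+-congˡ (total-concat-tabulate (g ∘ suc)))

-- Weights of the avoiding words and the resulting series

module Weights {c ℓ} (R : CommutativeRing c ℓ) (p q u v s t : CommutativeRing.Carrier R) where
  open CommutativeRing R hiding (zero)
  open CommutativeSemiringExp commutativeSemiring using (_^_; ^-homo-*; ^-distrib-*)
  open MonoidSum +-monoid using (sum; sum-cong-≋)
  open GeneratingFunction R p q u v s t
  open Combinatorics
  open Total R
  open RingSolver R using (solve; _:=_; _:+_; _:*_; :1)
  open SetoidReasoning setoid

  monomial : (a d l r l′ r′ : ℕ) → Carrier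
  monomial a d l r l′ r′ = p ^ a * q ^ d * u ^ l * v ^ r * s ^ l′ * t ^ r′

  monomial-cong : ∀ {a a′ b b′ c c′ d d′ e e′ f f′} → a ≡ a′ → b ≡ b′ → c ≡ c′ → d ≡ d′ → e ≡ e′ → f ≡ f′ →
    monomial a b c d e f ≡ monomial a′ b′ c′ d′ e′ f′
  monomial-cong ≡.refl ≡.refl ≡.refl ≡.refl ≡.refl ≡.refl = ≡.refl

  -- The part of the weight that is independent of the lengths, for the identity and for a proper
  -- exchange. In `κ₂`, the factor `q` is the single descent and `s * s` the two left-to-right
  -- minima.
  κ₁ κ₂ : Carrier
  κ₁ = s * t * u * v
  κ₂ = q * (s * s) * t * u * v

  ptu^ : ∀ n → (p * t * u) ^ n ≈ p ^ n * t ^ n * u ^ n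
  ptu^ n = trans (^-distrib-* (p * t) u n) (*-congʳ (^-distrib-* p t n))

  weight-empty : (π : Word 0) → weight π ≈ 1#
  weight-empty π = solve 0 (:1 :* :1 :* :1 :* :1 :* :1 :* :1 := :1) refl

  weight-identity : ∀ n → weight (identity (suc n)) ≈ κ₁ * (p * t * u) ^ n
  weight-identity n = begin
    weight (identity (suc n))
      ≡⟨ monomial-cong asc-identity des-identity lrmax-identity rlmax-identity lrmin-identity rlmin-identity ⟩
    monomial n 0 (suc n) 1 1 (suc n)
      ≈⟨ solve 7 (λ P U T u v s t → P :* :1 :* (u :* U) :* (v :* :1) :* (s :* :1) :* (t :* T)
                    := s :* t :* u :* v :* (P :* T :* U)) refl (p ^ n) (u ^ n) (t ^ n) u v s t ⟩
    κ₁ * (p ^ n * t ^ n * u ^ n)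
      ≈⟨ *-congˡ (ptu^ n) ⟨
    κ₁ * (p * t * u) ^ n ∎
    where open IdentityStatistics (identity (suc n)) exchanges-identity

  module _ {m} (i : Fin (suc m)) (j : Fin (suc (m ∸ toℕ i))) where

    private
      a = toℕ i
      b = toℕ j
      π = rotationAt i j

    size : ∀ {c} → m ∸ a ∸ b ≡ c → suc a ℕ.+ suc b ℕ.+ c ≡ 2 ℕ.+ m
    size ≡.refl = ≡.trans
      (≡.cong₂ ℕ._+_ (ℕ.+-suc (suc a) b) (ℕ.∸-+-assoc m a b))
      (≡.cong (2 ℕ.+_) (ℕ.m+[n∸m]≡n
        (ℕ.s≤s⁻¹ (≡.subst (ℕ._≤ suc m) (ℕ.+-suc a b) (ℕ.s≤s⁻¹ (rotation-fits i j))))))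

    -- Beyond the constant part, each further letter of the front block contributes `p * u`, each of
    -- the middle block `p * t`, each fixed letter `p * t * u`. The factor `e` is what right-to-left
    -- maxima contribute beyond one `v`.
    weight-rotation-via : ∀ {c} → m ∸ a ∸ b ≡ c → ∀ e → v ^ rlmax π ≈ v * e →
      weight π ≈ κ₂ * ((p * u) ^ a * ((p * t) ^ b * (e * (p * t * u) ^ c)))
    weight-rotation-via {c} ≡c e rlmax≈ = begin
      weight π
        ≡⟨ monomial-cong asc-rotation des-rotation lrmax-rotation (≡.refl {x = rlmax π}) lrmin-rotation rlmin-rotation ⟩
      p ^ (a ℕ.+ b ℕ.+ c) * q ^ 1 * u ^ (suc a ℕ.+ c) * v ^ rlmax π * s ^ 2 * t ^ (suc b ℕ.+ c)
        ≈⟨ *-cong (*-congʳ (*-cong (*-cong (*-congʳ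
             (trans (^-homo-* p (a ℕ.+ b) c) (*-congʳ (^-homo-* p a b))))
             (*-congˡ (^-homo-* u a c))) rlmax≈)) (*-congˡ (^-homo-* t b c)) ⟩
      p ^ a * p ^ b * p ^ c * q ^ 1 * (u * (u ^ a * u ^ c)) * (v * e) * s ^ 2 * (t * (t ^ b * t ^ c))
        ≈⟨ solve 13 (λ pa pb pc ua uc tb tc q u v s t e →
             pa :* pb :* pc :* (q :* :1) :* (u :* (ua :* uc)) :* (v :* e) :* (s :* (s :* :1)) :* (t :* (tb :* tc))
             := q :* (s :* s) :* t :* u :* v :* (pa :* ua :* (pb :* tb :* (e :* (pc :* tc :* uc)))))
             refl (p ^ a) (p ^ b) (p ^ c) (u ^ a) (u ^ c) (t ^ b) (t ^ c) q u v s t e ⟩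
      κ₂ * (p ^ a * u ^ a * (p ^ b * t ^ b * (e * (p ^ c * t ^ c * u ^ c))))
        ≈⟨ *-congˡ (*-cong (^-distrib-* p u a) (*-cong (^-distrib-* p t b) (*-congˡ (ptu^ c)))) ⟨
      κ₂ * ((p * u) ^ a * ((p * t) ^ b * (e * (p * t * u) ^ c))) ∎
      where open RotationStatistics (size ≡c) π (exchanges-rotationAt i j)

  open Series R hiding (_⊕_; _⊛_)
  open SeriesProperties R

  tail : PowerSeries
  tail = (C v S.- S.1#) ⊞ geometric (p * t * u)

  weight-rotation : ∀ {m} (i : Fin (suc m)) (j : Fin (suc (m ∸ toℕ i))) →
    ∀ c → m ∸ toℕ i ∸ toℕ j ≡ c →
    weight (rotationAt i j) ≈ κ₂ * ((p * u) ^ toℕ i * ((p * t) ^ toℕ j * coeff tail c))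
  weight-rotation i j zero ≡c = trans
    (weight-rotation-via i j ≡c v (begin
      v ^ rlmax π  ≡⟨ ≡.cong (v ^_) (rlmax-rotation-full
                        (≡.trans (≡.sym (ℕ.+-identityʳ _)) (size i j ≡c)) π (exchanges-rotationAt i j)) ⟩
      v * (v * 1#) ≈⟨ *-congˡ (*-identityʳ v) ⟩
      v * v ∎))
    (*-congˡ (*-congˡ (*-congˡ (begin
      v * 1#            ≈⟨ *-identityʳ v ⟩
      v                 ≈⟨ +-identityʳ v ⟨
      v + 0#            ≈⟨ +-congˡ (-‿inverseˡ 1#) ⟨
      v + (- 1# + 1#)   ≈⟨ +-assoc _ _ _ ⟨
      v - 1# + 1#       ∎))))
    where π = rotationAt i j
  weight-rotation i j (suc c) ≡c = trans
    (weight-rotation-via i j ≡c 1#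
      (reflexive (≡.cong (v ^_) (rlmax-rotation-partial (size i j ≡c) π (exchanges-rotationAt i j)))))
    (*-congˡ (*-congˡ (*-congˡ (begin
      1# * r ^ suc c         ≈⟨ *-identityˡ _ ⟩
      r ^ suc c              ≈⟨ +-identityˡ _ ⟨
      -- In positive degree, `0# - 0#` is the coefficient of `C v S.- S.1#`.
      0# + r ^ suc c         ≈⟨ +-congʳ (-‿inverseʳ 0#) ⟨
      0# - 0# + r ^ suc c    ∎))))
    where
    π = rotationAt i j
    r = p * t * u

  rotationSeries : PowerSeries
  rotationSeries = geometric (p * u) ⊠ (geometric (p * t) ⊠ tail)

  total-rotations : ∀ m → total weight (concat (rotations m)) ≈ κ₂ * coeff rotationSeries m
  total-rotations m = begin
    total weight (concat (rotations m))
      ≈⟨ total-concat-tabulate weight {suc m} (λ i → tabulate (rotationAt i)) ⟩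
    sum {suc m} (λ i → total weight (tabulate (rotationAt i)))
      ≈⟨ sum-cong-≋ {suc m} (λ i → trans (reflexive (total-tabulate weight (rotationAt i)))
           (sum-cong-≋ {suc (m ∸ toℕ i)} (λ j → weight-rotation i j _ ≡.refl))) ⟩
    sum {suc m} (λ i → sum {suc (m ∸ toℕ i)} λ j → κ₂ * ((p * u) ^ toℕ i * rest i j))
      ≈⟨ sum-cong-≋ {suc m} (λ i → trans
           (sym (*-distribˡ-sum {suc (m ∸ toℕ i)} κ₂ (λ j → (p * u) ^ toℕ i * rest i j)))
           (*-congˡ (sym (*-distribˡ-sum {suc (m ∸ toℕ i)} ((p * u) ^ toℕ i) (rest i))))) ⟩
    sum {suc m} (λ i → κ₂ * ((p * u) ^ toℕ i * sum {suc (m ∸ toℕ i)} (rest i)))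
      -- Once `κ₂` is pulled out, the double sum is the coefficient of the threefold product by
      -- definition of the convolution.
      ≈⟨ *-distribˡ-sum {suc m} κ₂ (λ i → (p * u) ^ toℕ i * sum {suc (m ∸ toℕ i)} (rest i)) ⟨
    κ₂ * coeff rotationSeries m ∎
    where
    open SemiringSum semiring using (*-distribˡ-sum)
    rest : (i : Fin (suc m)) → Fin (suc (m ∸ toℕ i)) → Carrier
    rest i j = (p * t) ^ toℕ j * coeff tail (m ∸ toℕ i ∸ toℕ j)

  -- Multiplication by `X` shifts coefficients. The identities of positive length are shifted once
  -- and the proper exchanges, which need two letters, twice; the clauses of `avoiders` match these
  -- offsets.
  expansion : genFun ⟨132⟩ ⟨321⟩ ≋
    S.1# ⊞ C κ₁ ⊠ (X ⊠ geometric (p * t * u)) ⊞ C κ₂ ⊠ (X ⊠ (X ⊠ rotationSeries))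
  expansion n = trans (total-↭ weight (𝒮↭avoiders n)) (trans (coefficient n)
    (sym (+-cong (+-congˡ (C-⊠ κ₁ (X ⊠ g) n)) (C-⊠ κ₂ (X ⊠ (X ⊠ rotationSeries)) n))))
    where
    g = geometric (p * t * u)
    coefficient : ∀ n → total weight (avoiders n) ≈
      coeff S.1# n + κ₁ * coeff (X ⊠ g) n + κ₂ * coeff (X ⊠ (X ⊠ rotationSeries)) n
    coefficient zero = begin
      weight (identity 0) + 0#    ≈⟨ +-congʳ (weight-empty (identity 0)) ⟩
      1# + 0#                     ≈⟨ +-cong (trans (sym (+-identityʳ 1#)) (+-congˡ (sym (zeroʳ κ₁)))) (sym (zeroʳ κ₂)) ⟩
      1# + κ₁ * 0# + κ₂ * 0#      ≈⟨ +-cong (+-congˡ (*-congˡ (X-⊠-zero g))) (*-congˡ (X-⊠-zero (X ⊠ rotationSeries))) ⟨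
      _ ∎
    coefficient (suc zero) = begin
      weight (identity 1) + 0#
        ≈⟨ +-cong (trans (weight-identity 0) (sym (+-identityˡ _))) (sym (zeroʳ κ₂)) ⟩
      0# + κ₁ * 1# + κ₂ * 0#
        ≈⟨ +-cong (+-congˡ (*-congˡ (X-⊠-suc g 0)))
                  (*-congˡ (trans (X-⊠-suc (X ⊠ rotationSeries) 0) (X-⊠-zero rotationSeries))) ⟨
      _ ∎
    coefficient (suc (suc m)) = begin
      weight (identity (2 ℕ.+ m)) + total weight (concat (rotations m))
        ≈⟨ +-cong (trans (weight-identity (suc m)) (sym (+-identityˡ _))) (total-rotations m) ⟩
      0# + κ₁ * (p * t * u) ^ suc m + κ₂ * coeff rotationSeries m
        ≈⟨ +-cong (+-congˡ (*-congˡ (X-⊠-suc g (suc m))))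
                  (*-congˡ (trans (X-⊠-suc (X ⊠ rotationSeries) (suc m)) (X-⊠-suc rotationSeries m))) ⟨
      _ ∎

-- From the expansion to the fraction

module _ {c ℓ} (R : CommutativeRing c ℓ) (p q u v s t : CommutativeRing.Carrier R) where
  open Series R
  open SeriesProperties R hiding (module S)
  open Weights R p q u v s t
  open GeneratingFunction R p q u v s t
  private
    module R = CommutativeRing R
    module S = CommutativeRing commutativeRing
  open Fraction commutativeRing
  open Algebra.Properties.Semiring.Exp S.semiring using (_^_)
  open SetoidReasoning S.setoid

  C-homo-*₃ : ∀ a b c → C (a R.* b R.* c) ≋ C a ⊠ C b ⊠ C c
  C-homo-*₃ a b c = begin
    C (a R.* b R.* c)    ≈⟨ C-homo-* (a R.* b) c ⟩
    C (a R.* b) ⊠ C c    ≈⟨ S.*-congʳ {C c} {C (a R.* b)} {C a ⊠ C b} (C-homo-* a b) ⟩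
    C a ⊠ C b ⊠ C c      ∎

  C-homo-*₄ : ∀ a b c d → C (a R.* b R.* c R.* d) ≋ C a ⊠ C b ⊠ C c ⊠ C d
  C-homo-*₄ a b c d = begin
    C (a R.* b R.* c R.* d)    ≈⟨ C-homo-* (a R.* b R.* c) d ⟩
    C (a R.* b R.* c) ⊠ C d    ≈⟨ S.*-congʳ {C d} {C (a R.* b R.* c)} {C a ⊠ C b ⊠ C c} (C-homo-*₃ a b c) ⟩
    C a ⊠ C b ⊠ C c ⊠ C d      ∎

  C-homo-κ₂ : C κ₂ ≋ C q ⊠ (C s ⊠ C s) ⊠ C t ⊠ C u ⊠ C v
  C-homo-κ₂ = begin
    C κ₂
      ≈⟨ C-homo-*₄ (q R.* (s R.* s)) t u v ⟩
    C (q R.* (s R.* s)) ⊠ C t ⊠ C u ⊠ C v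
      ≈⟨ S.*-congʳ {C v} {C (q R.* (s R.* s)) ⊠ C t ⊠ C u} {C q ⊠ (C s ⊠ C s) ⊠ C t ⊠ C u}
         (S.*-congʳ {C u} {C (q R.* (s R.* s)) ⊠ C t} {C q ⊠ (C s ⊠ C s) ⊠ C t}
         (S.*-congʳ {C t} {C (q R.* (s R.* s))} {C q ⊠ (C s ⊠ C s)} (begin
           C (q R.* (s R.* s))   ≈⟨ C-homo-* q (s R.* s) ⟩
           C q ⊠ C (s R.* s)     ≈⟨ S.*-congˡ {C q} {C (s R.* s)} {C s ⊠ C s} (C-homo-* s s) ⟩
           C q ⊠ (C s ⊠ C s)     ∎))) ⟩
    C q ⊠ (C s ⊠ C s) ⊠ C t ⊠ C u ⊠ C v ∎

  -- The ratio `r` is a product formed in `R`, while the denominator contains a product of constant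
  -- series; `d` bridges the two.
  denominator-inverse : ∀ r d → C r ≋ d → (S.1# S.- d ⊠ X) ⊠ geometric r ≋ S.1#
  denominator-inverse r d Cr≋d = begin
    (S.1# S.- d ⊠ X) ⊠ geometric r
      ≈⟨ S.*-congʳ {geometric r} {S.1# S.- C r ⊠ X} {S.1# S.- d ⊠ X}
         (S.+-congˡ {S.1#} {S.- (C r ⊠ X)} {S.- (d ⊠ X)}
         (S.-‿cong {C r ⊠ X} {d ⊠ X} (S.*-congʳ {X} {C r} {d} Cr≋d))) ⟨
    (S.1# S.- C r ⊠ X) ⊠ geometric r
      ≈⟨ geometric-inverse r ⟩
    S.1# ∎

  genFun-fraction : genFun ⟨132⟩ ⟨321⟩ ≈
    numerator commutativeRing X (C p) (C q) (C u) (C v) (C s) (C t) /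
    ((S.1# S.- C p ⊠ C t ⊠ X) ⊠ (S.1# S.- C p ⊠ C u ⊠ X) ⊠ (S.1# S.- C p ⊠ C t ⊠ C u ⊠ X))
  genFun-fraction = partialFractions commutativeRing
    {k₁ = C s ⊠ C t ⊠ C u ⊠ C v ⊠ X} {k₂ = C q ⊠ C s ^ 2 ⊠ C t ⊠ C u ⊠ C v ⊠ X ^ 2} {w = C v S.- S.1#}
    (geometric (p R.* t)) (geometric (p R.* u)) (geometric (p R.* t R.* u))
    (denominator-inverse (p R.* t) (C p ⊠ C t) (C-homo-* p t))
    (denominator-inverse (p R.* u) (C p ⊠ C u) (C-homo-* p u))
    (denominator-inverse (p R.* t R.* u) (C p ⊠ C t ⊠ C u) (C-homo-*₃ p t u))
    (numerator-partialFractions commutativeRing X (C p) (C q) (C u) (C v) (C s) (C t))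
    (λ n → R.trans (expansion n) (regroup commutativeRing (C q) (C u) (C v) (C s) (C t) X (C κ₁) (C κ₂)
      (geometric (p R.* t R.* u)) rotationSeries (C-homo-*₄ s t u v) C-homo-κ₂ n))

theorem5 :
    let open CommutativeRing ℤ⟦ 7 ⟧ hiding (_≈_)
        open Algebra.Properties.Semiring.Exp semiring using (_^_)
        open Fraction ℤ⟦ 7 ⟧
        x = var 7 0F
        p = var 7 1F
        q = var 7 2F
        u = var 7 3F
        v = var 7 4F
        s = var 7 5F
        t = var 7 6F
        A = 1# + s * t * u * v * x + q * s ^ 2 * t * u * v ^ 2 * x ^ 2
              - p ^ 3 * t ^ 2 * u ^ 2 * x ^ 3
              + p ^ 2 * t * u * x ^ 2 * (1# + t + u + s * t * u * v * x)
              - p * x * (u + s * t ^ 2 * u * v * x * (1# + q * s * u * (v - 1#) * x)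
                           + t * (1# + u + s * u ^ 2 * v * x))
    in F ⟨132⟩ ⟨321⟩ ≈ A / ((1# - p * t * x) * (1# - p * u * x) * (1# - p * t * u * x))
-- `var 7 0F` is `X` over `ℤ⟦ 6 ⟧` by definition, and each other variable is `C` of a variable of
-- `ℤ⟦ 6 ⟧`, so the general identity specialises without any conversion.
theorem5 = genFun-fraction ℤ⟦ 6 ⟧ (var 6 0F) (var 6 1F) (var 6 2F) (var 6 3F) (var 6 4F) (var 6 5F)
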